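{- For any integer $m\geq 3$ and any positive integer $k$, $$\chi_p(K_{m\star k})\leq \left(m+\frac{1}{2}-\sqrt{2m-2}\right)k.$$
   Context: $K_{m\star k}$ denotes the complete multipartite graph with exactly $k$ partite sets, each of size $m$. On-line $f$-list coloring game. Given a finite simple graph $G$ and an integer-valued function $f$ on $V(G)$, two players Alice and Bob play as follows. Initially all vertices are uncolored. In round $i$, Alice marks a nonempty subset $V_i$ of the remaining uncolored vertices (assigning color $i$ as a permissible color to each vertex of $V_i$); then Bob chooses an independent set $X_i\subseteq V_i$ and colors all vertices of $X_i$ with color $i$. If at the end of some round there is a vertex $v$ that has been marked $f(v)$ times but is not yet colored, Alice wins. Otherwise Bob wins, i.e. in the end each vertex $v$ is colored by Bob before running out of $f(v)$ permissible colors. $G$ is on-line $f$-choosable if Bob has a winning strategy, and on-line $k$-choosable if this holds for the constant function $f\equiv k$. The on-line choice number $\chi_p(G)$ (the subscript $p$ is just notation) is the minimum $k$ such that $G$ is on-line $k$-choosable. -}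

module Defs where

open import Data.Fin using (Fin; quotient)
open import Data.Fin.Properties using () renaming (_≟_ to _≟ᶠ_)
open import Data.Fin.Subset using (Subset; _∈_; _⊆_; _─_; ⊤; Nonempty)
open import Data.Fin.Subset.Properties using (_∈?_)
import Data.Integer as ℤ
open import Data.Nat as ℕ using (ℕ; suc)
open import Data.Product using (_×_; _,_; ∃-syntax)
open import Data.Rational
  using (ℚ; 0ℚ; 1ℚ; _+_; _*_; -_; _-_; _÷_; 1/_; _/_; _<_; _≤_; Positive; NonZero; positive; nonNegative)
open import Data.Rational.Properties
open import Algebra.Properties.Group +-0-group using (⁻¹-involutive)
open import Data.Rational.Solver using (module +-*-Solver)
open import Data.Sum using (_⊎_; inj₁; inj₂; swap)
open import Function.Bundles using (_⇔_; mk⇔; module Equivalence)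
open import Relation.Binary.Definitions using (Decidable; Irreflexive; Symmetric; tri<; tri≈; tri>)
open import Relation.Binary.PropositionalEquality
  using (_≡_; _≢_; refl; sym; trans; cong; subst; subst₂; ≢-sym)
open import Relation.Nullary using (¬_; yes; no; ¬?)

record Graph (n : ℕ) : Set₁ where
  field
    _~_      : Fin n → Fin n → Set
    ~-sym    : Symmetric _~_
    ~-irrefl : Irreflexive _≡_ _~_
    _~?_     : Decidable _~_

-- The graph with k partite sets, each of size m: the vertices are the
-- elements of Fin (k * m) ≅ Fin k × Fin m, and `quotient m` is the
-- first projection, i.e. the partite set of a vertex.

completeMultipartite : (m k : ℕ) → Graph (k ℕ.* m)
completeMultipartite m k = record
  { _~_      = λ u v → quotient {k} m u ≢ quotient {k} m v
  ; ~-sym    = ≢-sym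
  ; ~-irrefl = λ { refl u≢u → u≢u refl }
  ; _~?_     = λ u v → ¬? (quotient {k} m u ≟ᶠ quotient {k} m v)
  }

module _ {n : ℕ} (G : Graph n) where
  open Graph G

  Independent : Subset n → Set
  Independent X = ∀ {u v} → u ∈ X → v ∈ X → ¬ (u ~ v)

  mark : Subset n → (Fin n → ℕ) → Fin n → ℕ
  mark V t v with v ∈? V
  ... | yes _ = suc (t v)
  ... | no  _ = t v

  -- BobWins f U t: Bob has a winning strategy from the position in which
  -- U is the set of uncoloured vertices and each v has been marked t v
  -- times.  The first component says that Alice has not already won.  It
  -- is required in the initial position as well, so that a vertex with
  -- f v = 0 has no permissible colour even in the first round.  An
  -- element of this inductive type is a well-founded strategy tree; Bob
  -- wins at the leaves, where U is empty and Alice has no move.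

  data BobWins (f : Fin n → ℕ) (U : Subset n) (t : Fin n → ℕ) : Set where
    play : (∀ {v} → v ∈ U → t v ℕ.< f v) →
           (∀ V → Nonempty V → V ⊆ U →
              ∃[ X ] X ⊆ V × Independent X × BobWins f (U ─ X) (mark V t)) →
           BobWins f U t

  OnlineChoosable : (Fin n → ℕ) → Set
  OnlineChoosable f = BobWins f ⊤ (λ _ → 0)

  IsOnlineChoiceNumber : ℕ → Set
  IsOnlineChoiceNumber c =
    OnlineChoosable (λ _ → c) × (∀ d → OnlineChoosable (λ _ → d) → c ℕ.≤ d)

-- Real numbers as two-sided Dedekind cuts of rationals: L q means q < x
-- and U q means x < q.

record ℝ : Set₁ where
  field
    L U         : ℚ → Set
    L-inhabited : ∃[ q ] L q
    U-inhabited : ∃[ q ] U q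
    L-rounded   : ∀ q → L q ⇔ (∃[ r ] q < r × L r)
    U-rounded   : ∀ q → U q ⇔ (∃[ r ] r < q × U r)
    disjoint    : ∀ q → ¬ (L q × U q)
    located     : ∀ {q r} → q < r → L q ⊎ U r

infix 4 _≤ᵣ_
_≤ᵣ_ : ℝ → ℝ → Set
x ≤ᵣ y = ∀ q → ℝ.L x q → ℝ.L y q

fromℚ : ℚ → ℝ
fromℚ p = record
  { L           = _< p
  ; U           = p <_
  ; L-inhabited = p - 1ℚ , below p
  ; U-inhabited = p + 1ℚ , above p
  ; L-rounded   = λ q → mk⇔ <-dense (λ (r , q<r , r<p) → <-trans q<r r<p)
  ; U-rounded   = λ q → mk⇔
      (λ p<q → let (r , p<r , r<q) = <-dense p<q in r , r<q , p<r)
      (λ (r , r<q , p<r) → <-trans p<r r<q)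
  ; disjoint    = λ q (q<p , p<q) → <-asym q<p p<q
  ; located     = loc
  }
  where
  0<1 : 0ℚ < 1ℚ
  0<1 = positive⁻¹ 1ℚ
  above : ∀ p → p < p + 1ℚ
  above p = subst (_< p + 1ℚ) (+-identityʳ p) (+-monoʳ-< p 0<1)
  below : ∀ p → p - 1ℚ < p
  below p = subst (p - 1ℚ <_) (+-identityʳ p) (+-monoʳ-< p (neg-antimono-< 0<1))
  loc : ∀ {q r} → q < r → q < p ⊎ p < r
  loc {q} q<r with <-cmp q p
  ... | tri< q<p _ _  = inj₁ q<p
  ... | tri≈ _ refl _ = inj₂ q<r
  ... | tri> _ _ p<q  = inj₂ (<-trans p<q q<r)

-ᵣ_ : ℝ → ℝ
-ᵣ x = record
  { L           = λ q → U (- q)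
  ; U           = λ q → L (- q)
  ; L-inhabited = let (q , Uq) = U-inhabited in - q , subst U (sym (neg-neg q)) Uq
  ; U-inhabited = let (q , Lq) = L-inhabited in - q , subst L (sym (neg-neg q)) Lq
  ; L-rounded   = λ q → mk⇔
      (λ u → let (r , r< , Ur) = Equivalence.to (U-rounded (- q)) u in
             - r , subst (_< - r) (neg-neg q) (neg-antimono-< r<) , subst U (sym (neg-neg r)) Ur)
      (λ (r , q<r , Ur) → Equivalence.from (U-rounded (- q)) (- r , neg-antimono-< q<r , Ur))
  ; U-rounded   = λ q → mk⇔
      (λ l → let (r , <r , Lr) = Equivalence.to (L-rounded (- q)) l in
             - r , subst (- r <_) (neg-neg q) (neg-antimono-< <r) , subst L (sym (neg-neg r)) Lr)
      (λ (r , r<q , Lr) → Equivalence.from (L-rounded (- q)) (- r , neg-antimono-< r<q , Lr))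
  ; disjoint    = λ q (u , l) → disjoint (- q) (l , u)
  ; located     = λ q<r → swap (located (neg-antimono-< q<r))
  }
  where
  open ℝ x
  neg-neg : ∀ q → - (- q) ≡ q
  neg-neg = ⁻¹-involutive

-- The image of x under the increasing bijection f⁻¹ of ℚ.

transport : (f f⁻¹ : ℚ → ℚ) → (∀ {p q} → p < q → f p < f q) →
            (∀ {p q} → p < q → f⁻¹ p < f⁻¹ q) →
            (∀ q → f (f⁻¹ q) ≡ q) → (∀ q → f⁻¹ (f q) ≡ q) → ℝ → ℝ
transport f f⁻¹ f-mono f⁻¹-mono ff⁻¹ f⁻¹f x = record
  { L           = λ q → L (f q)
  ; U           = λ q → U (f q)
  ; L-inhabited = let (q , Lq) = L-inhabited in f⁻¹ q , subst L (sym (ff⁻¹ q)) Lq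
  ; U-inhabited = let (q , Uq) = U-inhabited in f⁻¹ q , subst U (sym (ff⁻¹ q)) Uq
  ; L-rounded   = λ q → mk⇔
      (λ l → let (r , <r , Lr) = Equivalence.to (L-rounded (f q)) l in
             f⁻¹ r , subst (_< f⁻¹ r) (f⁻¹f q) (f⁻¹-mono <r) , subst L (sym (ff⁻¹ r)) Lr)
      (λ (r , q<r , Lr) → Equivalence.from (L-rounded (f q)) (f r , f-mono q<r , Lr))
  ; U-rounded   = λ q → mk⇔
      (λ u → let (r , r< , Ur) = Equivalence.to (U-rounded (f q)) u in
             f⁻¹ r , subst (f⁻¹ r <_) (f⁻¹f q) (f⁻¹-mono r<) , subst U (sym (ff⁻¹ r)) Ur)
      (λ (r , r<q , Ur) → Equivalence.from (U-rounded (f q)) (f r , f-mono r<q , Ur))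
  ; disjoint    = λ q → disjoint (f q)
  ; located     = λ q<r → located (f-mono q<r)
  }
  where open ℝ x

infixl 6 _-ᵣ_
_-ᵣ_ : ℚ → ℝ → ℝ
p -ᵣ x = transport (_- p) (_+ p) (+-monoˡ-< (- p)) (+-monoˡ-< p)
  (λ q → solve 2 (λ p q → (q :+ p) :- p := q) refl p q)
  (λ q → solve 2 (λ p q → (q :- p) :+ p := q) refl p q)
  (-ᵣ x)
  where open +-*-Solver

infixl 7 _*ᵣ_
_*ᵣ_ : ℝ → (k : ℕ) → .{{ℕ.NonZero k}} → ℝ
x *ᵣ k = transport (_÷ κ) (_* κ)
  (*-monoˡ-<-pos (1/ κ) {{1/pos⇒pos κ}}) (*-monoˡ-<-pos κ)
  (λ q → trans (*-assoc q κ (1/ κ)) (trans (cong (q *_) (*-inverseʳ κ)) (*-identityʳ q)))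
  (λ q → trans (*-assoc q (1/ κ) κ) (trans (cong (q *_) (*-inverseˡ κ)) (*-identityʳ q)))
  x
  where
  κ : ℚ
  κ = ℤ.+ k / 1
  instance
    κ-pos : Positive κ
    κ-pos = normalize-pos k 1
    κ-nonZero : NonZero κ
    κ-nonZero = pos⇒nonZero κ

-- Roundedness of √ n uses, for q ≥ 0 and B² > n, the point
-- r = (q B + n) / (q + B) between q and √n, for which
-- r - q = (n - q²) / (q + B) and n - r² = (n - q²) (B² - n) / (q + B)².

√ : ℕ → ℝ
√ n = record
  { L           = Lo
  ; U           = Up
  ; L-inhabited = - 1ℚ , inj₁ (neg-antimono-< 0<1)
  ; U-inhabited = B , 0<B , N<B²
  ; L-rounded   = λ q → mk⇔ (Lo-open q) (λ (r , q<r , l) → Lo-closed q<r l)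
  ; U-rounded   = λ q → mk⇔ (Up-open q) (λ (r , r<q , u) → Up-closed r<q u)
  ; disjoint    = λ { q (inj₁ q<0 , 0<q , _)  → <-asym q<0 0<q
                    ; q (inj₂ q²<N , _ , N<q²) → <-asym q²<N N<q² }
  ; located     = loc
  }
  where
  open +-*-Solver
  N B : ℚ
  N = ℤ.+ n / 1
  B = N + 1ℚ

  Lo Up : ℚ → Set
  Lo q = q < 0ℚ ⊎ q * q < N
  Up q = 0ℚ < q × N < q * q

  0<1 : 0ℚ < 1ℚ
  0<1 = positive⁻¹ 1ℚ

  0≤N : 0ℚ ≤ N
  0≤N = nonNegative⁻¹ N {{normalize-nonNeg n 1}}

  0<B : 0ℚ < B
  0<B = +-mono-≤-< 0≤N 0<1

  diff : ∀ {p q} → p < q → 0ℚ < q - p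
  diff {p} {q} p<q = subst (_< q - p) (+-inverseʳ p) (+-monoˡ-< (- p) p<q)

  undiff : ∀ {p q} → 0ℚ < q - p → p < q
  undiff {p} {q} 0<d = subst₂ _<_ (+-identityˡ p)
    (solve 2 (λ p q → (q :- p) :+ p := q) refl p q) (+-monoˡ-< p 0<d)

  0<* : ∀ {p q} → 0ℚ < p → 0ℚ < q → 0ℚ < p * q
  0<* {p} {q} 0<p 0<q =
    positive⁻¹ (p * q) {{pos*pos⇒pos p {{positive 0<p}} q {{positive 0<q}}}}

  square-≤ : ∀ {p q} → 0ℚ ≤ p → p ≤ q → p * p ≤ p * q
  square-≤ {p} 0≤p = *-monoˡ-≤-nonNeg p {{nonNegative 0≤p}}

  square-< : ∀ {p q} → 0ℚ ≤ p → p < q → p * p < q * q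
  square-< {p} {q} 0≤p p<q = ≤-<-trans (square-≤ 0≤p (<⇒≤ p<q))
    (*-monoˡ-<-pos q {{positive (≤-<-trans 0≤p p<q)}} p<q)

  N<B² : N < B * B
  N<B² = <-≤-trans N<B (subst (_≤ B * B) (*-identityˡ B)
    (*-monoʳ-≤-nonNeg B {{nonNegative (<⇒≤ 0<B)}} (+-monoˡ-≤ 1ℚ 0≤N)))
    where
    N<B : N < B
    N<B = subst (_< B) (+-identityʳ N) (+-monoʳ-< N 0<1)

  secant₁ : ∀ q B N i → (N - q * q) * i ≡ (q * B + N) * i - q * ((q + B) * i)
  secant₁ = solve 4 (λ q B N i →
    (N :- q :* q) :* i := (q :* B :+ N) :* i :- q :* ((q :+ B) :* i)) refl

  secant₂ : ∀ q B N i → (N - q * q) * (B * B - N) * (i * i) ≡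
            N * (((q + B) * i) * ((q + B) * i)) - ((q * B + N) * i) * ((q * B + N) * i)
  secant₂ = solve 4 (λ q B N i → (N :- q :* q) :* (B :* B :- N) :* (i :* i)
    := N :* (((q :+ B) :* i) :* ((q :+ B) :* i))
       :- ((q :* B :+ N) :* i) :* ((q :* B :+ N) :* i)) refl

  flip : ∀ a b → - (a - b) ≡ b - a
  flip = solve 2 (λ a b → :- (a :- b) := b :- a) refl

  flip₁ : ∀ a b c → (a - b) * c ≡ - ((b - a) * c)
  flip₁ = solve 3 (λ a b c → (a :- b) :* c := :- ((b :- a) :* c)) refl

  flip₂ : ∀ a b c d → (a - b) * c * d ≡ - ((b - a) * c * d)
  flip₂ = solve 4 (λ a b c d → (a :- b) :* c :* d := :- ((b :- a) :* c :* d)) refl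

  module Secant (q : ℚ) (0≤q : 0ℚ ≤ q) where
    0<D : 0ℚ < q + B
    0<D = +-mono-≤-< 0≤q 0<B
    instance
      D-pos : Positive (q + B)
      D-pos = positive 0<D
      D-nonZero : NonZero (q + B)
      D-nonZero = pos⇒nonZero (q + B)
    i r : ℚ
    i = 1/ (q + B)
    r = (q * B + N) * i
    0<i : 0ℚ < i
    0<i = positive⁻¹ i {{1/pos⇒pos (q + B)}}
    Di≡1 : (q + B) * i ≡ 1ℚ
    Di≡1 = *-inverseʳ (q + B)

    r-q : (N - q * q) * i ≡ r - q
    r-q = trans (secant₁ q B N i)
      (cong (λ e → r - e) (trans (cong (q *_) Di≡1) (*-identityʳ q)))

    N-r² : (N - q * q) * (B * B - N) * (i * i) ≡ N - r * r
    N-r² = trans (secant₂ q B N i)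
      (cong (_- r * r) (trans (cong (λ e → N * (e * e)) Di≡1) (*-identityʳ N)))

    below : q * q < N → q < r × r * r < N
    below q²<N =
      undiff (subst (0ℚ <_) r-q (0<* (diff q²<N) 0<i)) ,
      undiff (subst (0ℚ <_) N-r² (0<* (0<* (diff q²<N) (diff N<B²)) (0<* 0<i 0<i)))

    above : N < q * q → r < q × N < r * r
    above N<q² =
      undiff (subst (0ℚ <_)
        (trans (flip₁ (q * q) N i) (trans (cong (λ e → - e) r-q) (flip r q)))
        (0<* (diff N<q²) 0<i)) ,
      undiff (subst (0ℚ <_)
        (trans (flip₂ (q * q) N (B * B - N) (i * i)) (trans (cong (λ e → - e) N-r²) (flip N (r * r))))
        (0<* (0<* (diff N<q²) (diff N<B²)) (0<* 0<i 0<i)))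

    0<r : 0ℚ < q → 0ℚ < r
    0<r 0<q = 0<* (+-mono-<-≤ (0<* 0<q 0<B) 0≤N) 0<i

  Lo-open : ∀ q → Lo q → ∃[ r ] q < r × Lo r
  Lo-open q (inj₁ q<0) = let (r , q<r , r<0) = <-dense q<0 in r , q<r , inj₁ r<0
  Lo-open q (inj₂ q²<N) with q <? 0ℚ
  ... | yes q<0 = Lo-open q (inj₁ q<0)
  ... | no  q≮0 = let open Secant q (≮⇒≥ q≮0); (q<r , r²<N) = below q²<N in
                  r , q<r , inj₂ r²<N

  Lo-closed : ∀ {q r} → q < r → Lo r → Lo q
  Lo-closed q<r (inj₁ r<0) = inj₁ (<-trans q<r r<0)
  Lo-closed {q} q<r (inj₂ r²<N) with q <? 0ℚ
  ... | yes q<0 = inj₁ q<0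
  ... | no  q≮0 = inj₂ (<-trans (square-< (≮⇒≥ q≮0) q<r) r²<N)

  Up-open : ∀ q → Up q → ∃[ r ] r < q × Up r
  Up-open q (0<q , N<q²) = let open Secant q (<⇒≤ 0<q); (r<q , N<r²) = above N<q² in
                           r , r<q , 0<r 0<q , N<r²

  Up-closed : ∀ {q r} → r < q → Up r → Up q
  Up-closed r<q (0<r , N<r²) = <-trans 0<r r<q , <-trans N<r² (square-< (<⇒≤ 0<r) r<q)

  loc : ∀ {q r} → q < r → Lo q ⊎ Up r
  loc {q} q<r with q <? 0ℚ | q * q <? N
  ... | yes q<0 | _        = inj₁ (inj₁ q<0)
  ... | no  _   | yes q²<N = inj₁ (inj₂ q²<N)
  ... | no  q≮0 | no q²≮N  = inj₂ (≤-<-trans (≮⇒≥ q≮0) q<r ,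
                                   ≤-<-trans (≮⇒≥ q²≮N) (square-< (≮⇒≥ q≮0) q<r))

{-# OPTIONS --safe #-}
module Submission where

-- Let g v be the number of marks that v can still take without losing.  Bob keeps the
-- uncoloured vertices in normal parts, an ordered list of single vertices, and an ordered
-- list of blocks of left-over vertices.  For every set S of s vertices of a normal part he
-- maintains, up to a small discount, g(S) ≥ Σ_{i<s} total i, where a normal part of size q
-- counts 1 at level 0 and max(q - i, 1) at level i ≥ 1.  If some marked set is tight, he takes a
-- largest one, of size t say, and colours all marked vertices of its part: each vertex left
-- over can then afford to wait for everything that is counted at level t, so the left-over
-- vertices form a block.  Marked sets larger than t are not tight, and this slack of 1 is what
-- they need.  If no marked set is tight, Bob colours the first marked single vertex; if there
-- is none, the first marked block or the part with the most marked vertices, depending on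
-- whether the type of that block is large enough.
--
-- For the parts of size m the condition reads s L + (s - 1) ≥ k G_s for 1 ≤ s < m, where
-- G_s = 1 + (m-1) + ... + (m-s+1) (the case s = m follows).  So L = max_{s<m} ⌊k G_s / s⌋ works, and
-- G_s / s = m + 1/2 - ((m-1)/s + s/2) is at most m + 1/2 - √(2m-2) by AM-GM.

open import Defs
open import Data.Fin using (Fin; quotient; remainder; combine)
import Data.Fin.Properties as Fin
open import Data.Fin.Subset as Subset using (Subset; inside; outside; ⁅_⁆; _∪_; _∩_; _─_; ∣_∣; Nonempty)
import Data.Fin.Subset.Properties as Subset
import Data.Integer as ℤ
import Data.Integer.Properties as ℤ
open import Data.List using (List; []; _∷_; _++_; map; length; filter; foldr; allFin; upTo)
open import Data.List.Properties using (length-filter; length-map; length-tabulate; map-∘; map-cong)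
open import Data.List.Membership.Propositional using (_∈_; find; lose)
open import Data.List.Membership.Propositional.Properties
  using (∈-filter⁺; ∈-filter⁻; ∈-map⁺; ∈-map⁻; ∈-allFin; ∈-upTo⁺; ∈-upTo⁻)
open import Data.List.Relation.Binary.Sublist.Propositional as Sublist
  using (_⊆_; []; _∷ʳ_; _∷_; ⊆-trans)
open import Data.List.Relation.Binary.Sublist.Propositional.Properties
  using (length-mono-≤; All-resp-⊆; filter-⊆)
open import Data.List.Relation.Unary.All as All using (All; []; _∷_)
import Data.List.Relation.Unary.All.Properties as All
open import Data.List.Relation.Unary.AllPairs using (AllPairs; []; _∷_)
open import Data.List.Relation.Unary.Any as Any using (Any; here; there)
import Data.List.Relation.Unary.Any.Properties as Any
open import Data.Nat as Nat hiding (_+_; _/_; _%_)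
open import Data.Nat.DivMod using (m≡m%n+[m/n]*n; m%n<n; m/n*n≤m)
open import Data.Nat.ListAction using (sum)
open import Data.Nat.Properties
open import Data.Nat.Tactic.RingSolver using (solve-∀)
open import Data.Product using (_×_; _,_; ∃-syntax; proj₁; proj₂)
open import Data.Rational using (ℚ)
import Data.Rational as ℚ
import Data.Rational.Properties as ℚ
open import Data.Rational.Solver using (module +-*-Solver)
import Data.Rational.Unnormalised as ℚᵘ
import Data.Rational.Unnormalised.Properties as ℚᵘ
open import Data.Sum using (_⊎_; inj₁; inj₂; [_,_]′)
open import Data.Unit using (⊤; tt)
open import Data.Vec using (_∷_; here; there)
open import Function using (_∘_)
open import Level using (0ℓ)
open import Relation.Binary.Definitions using (tri<; tri≈; tri>)
open import Relation.Binary.PropositionalEquality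
open import Relation.Nullary using (¬_; Dec; yes; no; ¬?; contradiction; _×-dec_; _→-dec_)
open import Relation.Nullary.Decidable using (map′; decidable-stable)
open import Relation.Unary using (Pred; Decidable; ∁)

-- Finite sums, weights of levels and discounts.

module _ where
  open Nat using (_+_)

  ∑ : ℕ → (ℕ → ℕ) → ℕ
  ∑ zero    a = 0
  ∑ (suc s) a = ∑ s a + a s

  ∑-mono : ∀ s {a b : ℕ → ℕ} → (∀ i → a i ≤ b i) → ∑ s a ≤ ∑ s b
  ∑-mono zero    a≤b = z≤n
  ∑-mono (suc s) a≤b = +-mono-≤ (∑-mono s a≤b) (a≤b s)

  ∑-+ : ∀ s (a b : ℕ → ℕ) → ∑ s (λ i → a i + b i) ≡ ∑ s a + ∑ s b
  ∑-+ zero    a b = refl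
  ∑-+ (suc s) a b = trans (cong (_+ (a s + b s)) (∑-+ s a b)) (eq (∑ s a) (∑ s b) (a s) (b s))
    where
    eq : ∀ w x y z → (w + x) + (y + z) ≡ (w + y) + (x + z)
    eq = solve-∀

  ∑-drop : ∀ s {a b δ : ℕ → ℕ} → (∀ i → a i + δ i ≤ b i) → ∑ s a + ∑ s δ ≤ ∑ s b
  ∑-drop s {a} {δ = δ} drop = ≤-trans (≤-reflexive (sym (∑-+ s a δ))) (∑-mono s drop)

  ∑-suc : ∀ s (a : ℕ → ℕ) → ∑ (suc s) a ≡ a 0 + ∑ s (a ∘ suc)
  ∑-suc zero    a = sym (+-identityʳ (a 0))
  ∑-suc (suc s) a = trans (cong (_+ a (suc s)) (∑-suc s a)) (+-assoc (a 0) _ _)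

  -- The contribution at level i of a normal part of size q ≥ 2.
  weight : ℕ → ℕ → ℕ
  weight zero    q = 1
  weight (suc i) q = (q ∸ suc i) ⊔ 1

  weight-mono : ∀ i {p q} → p ≤ q → weight i p ≤ weight i q
  weight-mono zero    p≤q = ≤-refl
  weight-mono (suc i) p≤q = ⊔-monoˡ-≤ 1 (∸-monoˡ-≤ (suc i) p≤q)

  weight-pos : ∀ i q → 1 ≤ weight i q
  weight-pos zero    q = ≤-refl
  weight-pos (suc i) q = m≤n⊔m (q ∸ suc i) 1

  weight-lower : ∀ i q → q ≤ suc i + weight (suc i) q
  weight-lower i q = ≤-trans (m≤n+m∸n q (suc i)) (+-monoʳ-≤ (suc i) (m≤m⊔n (q ∸ suc i) 1))

  weight-upper : ∀ i {q} → 1 ≤ q → weight i q ≤ q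
  weight-upper zero    1≤q = 1≤q
  weight-upper (suc i) 1≤q = ⊔-lub (m∸n≤m _ (suc i)) 1≤q

  -- s - 1 for a proper subset of a part of size q, and q - 2 for the whole part.  It absorbs
  -- the rounding in L.
  discount : ℕ → ℕ → ℕ
  discount s q = pred (s ⊓ pred q)

  discount-1 : ∀ q → discount 1 q ≡ 0
  discount-1 zero          = refl
  discount-1 (suc zero)    = refl
  discount-1 (suc (suc q)) = refl

  n≤1+pred[n] : ∀ n → n ≤ suc (pred n)
  n≤1+pred[n] zero    = z≤n
  n≤1+pred[n] (suc n) = ≤-refl

  -- The discount differs from s - 1 only for the whole part, and there by at most one.
  discount-suc≤ : ∀ {s p} → s ≤ p → pred s ≤ suc (discount s p)
  discount-suc≤ {zero}  s≤p = z≤n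
  discount-suc≤ {suc s} {suc p} (s≤s s≤p) with m≤n⇒m<n∨m≡n s≤p
  ... | inj₁ s<p  rewrite m≤n⇒m⊓n≡m s<p = n≤1+n s
  ... | inj₂ refl rewrite m≥n⇒m⊓n≡n (n≤1+n s) = n≤1+pred[n] s

  discount-≤ : ∀ s q → discount s q ≤ pred s
  discount-≤ s q = pred-mono-≤ (m⊓n≤m s (pred q))

  -- If one vertex is left outside a set of s vertices of a part of size q,
  -- the discount it loses is made up by the weight of the part.
  discount-weight : ∀ s {q} → suc (suc s) ≤ q →
    suc (discount (suc (suc s)) q) ≤ weight (suc s) q + discount (suc s) q
  discount-weight s {suc (suc q)} (s≤s (s≤s s≤q)) with m≤n⇒m<n∨m≡n s≤q
  ... | inj₁ s<q  rewrite m≤n⇒m⊓n≡m s<q | m≤n⇒m⊓n≡m s≤q =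
    +-monoˡ-≤ s (≤-trans (≤-trans (s≤s (m<n⇒0<n∸m s<q)) (≤-reflexive (sym (+-∸-assoc 1 s≤q))))
                         (m≤m⊔n (suc q ∸ s) 1))
  ... | inj₂ refl rewrite m≥n⇒m⊓n≡n (n≤1+n s) | ⊓-idem s = +-monoˡ-≤ s (m≤n⊔m (suc s ∸ s) 1)

  ifType : ℕ → ℕ → ℕ → ℕ
  ifType i τ x with i ≤? τ
  ... | yes _ = x
  ... | no  _ = 0

  ifType-yes : ∀ {i τ} x → i ≤ τ → ifType i τ x ≡ x
  ifType-yes {i} {τ} x i≤τ with i ≤? τ
  ... | yes _   = refl
  ... | no  i≰τ = contradiction i≤τ i≰τ

  ifType-no : ∀ {i τ} x → τ < i → ifType i τ x ≡ 0
  ifType-no {i} {τ} x τ<i with i ≤? τ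
  ... | yes i≤τ = contradiction i≤τ (<⇒≱ τ<i)
  ... | no  _   = refl

  ifType-≤ : ∀ i τ x → ifType i τ x ≤ x
  ifType-≤ i τ x with i ≤? τ
  ... | yes _ = ≤-refl
  ... | no  _ = z≤n

  ifType-drop : ∀ i τ {x y d} → x + d ≤ y → ifType i τ x + ifType i τ d ≤ ifType i τ y
  ifType-drop i τ le with i ≤? τ
  ... | yes _ = le
  ... | no  _ = z≤n

-- A block of type τ consists of the vertices left over when Bob colours a part because of a
-- tight set of suc τ vertices; single vertices are blocks of type 0.
Block : Set → Set
Block A = ℕ × List A

-- Bookkeeping for lists of normal parts and lists of blocks.

module _ {A : Set} where
  open Nat using (_+_)

  level : ℕ → List (List A) → ℕ
  level i Ps = sum (map (weight i ∘ length) Ps)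

  size : List (Block A) → ℕ
  size Bs = sum (map (length ∘ proj₂) Bs)

  size-++ : ∀ Bs Cs → size (Bs ++ Cs) ≡ size Bs + size Cs
  size-++ []             Cs = refl
  size-++ ((τ , B) ∷ Bs) Cs = trans (cong (length B +_) (size-++ Bs Cs)) (sym (+-assoc (length B) _ _))

  -- The index is shifted by one: this is what the blocks contribute at level `suc i`, as no block
  -- counts at level 0.
  above : ℕ → List (Block A) → ℕ
  above i []             = 0
  above i ((τ , B) ∷ Bs) = ifType i τ (length B) + above i Bs

  above-++ : ∀ i Bs Cs → above i (Bs ++ Cs) ≡ above i Bs + above i Cs
  above-++ i []             Cs = refl
  above-++ i ((τ , B) ∷ Bs) Cs =
    trans (cong (ifType i τ (length B) +_) (above-++ i Bs Cs)) (sym (+-assoc (ifType i τ (length B)) _ _))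

  above-all : ∀ i {Bs} → All (λ b → i ≤ proj₁ b) Bs → above i Bs ≡ size Bs
  above-all i []                         = refl
  above-all i {(τ , B) ∷ Bs} (i≤τ ∷ i≤Bs) = cong₂ _+_ (ifType-yes (length B) i≤τ) (above-all i i≤Bs)

  -- A single vertex counts at all levels but level 0, and a vertex in a block of type τ counts
  -- at the levels 1, ..., suc τ.
  total : List (List A) → List (Block A) → List (Block A) → ℕ → ℕ
  total Ps Ss Bs zero    = level 0 Ps
  total Ps Ss Bs (suc i) = level (suc i) Ps + (size Ss + above i Bs)

  demand : List (List A) → List (Block A) → List (Block A) → ℕ → ℕ
  demand Ps Ss Bs s = ∑ s (total Ps Ss Bs)

  -- A vertex must outlast the base `b` of its type and all blocks before its own, since it may be
  -- marked in vain while each of these is served. The sizes already passed are added to the base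
  -- along the list.
  Ranked : (A → ℕ) → (ℕ → ℕ) → List (Block A) → Set
  Ranked g b []             = ⊤
  Ranked g b ((τ , B) ∷ Bs) = All (λ u → b τ < g u) B × Ranked g (λ σ → length B + b σ) Bs

  ranked-weaken : ∀ {g b b′} Bs → (∀ σ → b′ σ ≤ b σ) → Ranked g b Bs → Ranked g b′ Bs
  ranked-weaken []             b′≤b _        = tt
  ranked-weaken ((τ , B) ∷ Bs) b′≤b (rB , r) =
    All.map (≤-<-trans (b′≤b τ)) rB , ranked-weaken Bs (λ σ → +-monoʳ-≤ (length B) (b′≤b σ)) r

  ranked-++⁻ : ∀ {g b} Bs {Cs} → Ranked g b (Bs ++ Cs) → Ranked g b Bs × Ranked g (λ σ → size Bs + b σ) Cs
  ranked-++⁻ []             r = tt , r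
  ranked-++⁻ {b = b} ((τ , B) ∷ Bs) {Cs} (rB , r) =
    let (rBs , rCs) = ranked-++⁻ Bs r in
    (rB , rBs) , ranked-weaken Cs (λ σ → ≤-reflexive (eq (length B) (size Bs) (b σ))) rCs
    where
    eq : ∀ x y z → (x + y) + z ≡ y + (x + z)
    eq = solve-∀

  ranked-++⁺ : ∀ {g b} Bs {Cs} → Ranked g b Bs → Ranked g (λ σ → size Bs + b σ) Cs → Ranked g b (Bs ++ Cs)
  ranked-++⁺ []             _         rCs = rCs
  ranked-++⁺ {b = b} ((τ , B) ∷ Bs) {Cs} (rB , rBs) rCs =
    rB , ranked-++⁺ Bs rBs (ranked-weaken Cs (λ σ → ≤-reflexive (eq (length B) (size Bs) (b σ))) rCs)
    where
    eq : ∀ x y z → y + (x + z) ≡ (x + y) + z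
    eq = solve-∀

  -- The remaining list is described by its level sums and its members only; the order of the parts
  -- never matters.
  remove : ∀ {Q Ps} → Q ∈ Ps → ∃[ Ps₀ ]
    (∀ i → level i Ps ≡ weight i (length Q) + level i Ps₀) ×
    (∀ {P} → P ∈ Ps₀ → P ∈ Ps) × (∀ {P} → P ∈ Ps → P ≡ Q ⊎ P ∈ Ps₀)
  remove {Ps = Q ∷ Ps} (here refl) =
    Ps , (λ i → refl) , there , λ { (here eq) → inj₁ eq ; (there P∈) → inj₂ P∈ }
  remove {Q} {P ∷ Ps} (there Q∈) with remove Q∈
  ... | Ps₀ , lev , ⊆Ps , Ps⊆ =
    P ∷ Ps₀ ,
    (λ i → trans (cong (weight i (length P) +_) (lev i)) (eq (weight i (length P)) (weight i (length Q)) (level i Ps₀))) ,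
    (λ { (here eq) → here eq ; (there P∈) → there (⊆Ps P∈) }) ,
    λ { (here eq) → inj₂ (here eq) ; (there P∈) → [ inj₁ , inj₂ ∘ there ]′ (Ps⊆ P∈) }
    where
    eq : ∀ x y z → x + (y + z) ≡ y + (x + z)
    eq = solve-∀

  anySublist? : ∀ {Q : Pred (List A) 0ℓ} → Decidable Q → ∀ P → Dec (∃[ S ] S ⊆ P × Q S)
  anySublist? Q? [] = map′ (λ q → [] , [] , q) (λ { ([] , [] , q) → q }) (Q? [])
  anySublist? Q? (x ∷ P) with anySublist? Q? P | anySublist? (Q? ∘ (x ∷_)) P
  ... | yes (S , S⊆P , q) | _                 = yes (S , x ∷ʳ S⊆P , q)
  ... | no  _             | yes (S , S⊆P , q) = yes (x ∷ S , refl ∷ S⊆P , q)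
  ... | no  ¬p            | no  ¬q            = no λ
    { (S , _ ∷ʳ S⊆P , q)        → ¬p (S , S⊆P , q)
    ; (_ ∷ S , refl ∷ S⊆P , q) → ¬q (S , S⊆P , q) }

  -- All of `S` is marked and `u` is not, so the place of `u` in `P` is not yet taken. This extends
  -- a tight set by an unmarked vertex.
  insert : ∀ {M : Pred A 0ℓ} (g : A → ℕ) {S P u} → S ⊆ P → All M S → u ∈ P → ¬ M u →
    ∃[ S⁺ ] S⁺ ⊆ P × length S⁺ ≡ suc (length S) × sum (map g S⁺) ≡ g u + sum (map g S)
  insert g {S} (y ∷ʳ S⊆P) mS (here refl) ¬m = y ∷ S , refl ∷ S⊆P , refl , refl
  insert g (y ∷ʳ S⊆P) mS (there u∈P) ¬m =
    let (S⁺ , S⁺⊆P , len , sm) = insert g S⊆P mS u∈P ¬m in S⁺ , y ∷ʳ S⁺⊆P , len , sm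
  insert g (refl ∷ S⊆P) (m ∷ mS) (here refl) ¬m = contradiction m ¬m
  insert g {x ∷ S} {u = u} (refl ∷ S⊆P) (m ∷ mS) (there u∈P) ¬m =
    let (S⁺ , S⁺⊆P , len , sm) = insert g S⊆P mS u∈P ¬m in
    x ∷ S⁺ , refl ∷ S⁺⊆P , cong suc len , trans (cong (g x +_) sm) (eq (g x) (g u) (sum (map g S)))
    where
    eq : ∀ x y z → x + (y + z) ≡ y + (x + z)
    eq = solve-∀

-- Maximal choices in finite ranges and lists.

largest : ∀ {Q : Pred ℕ 0ℓ} → Decidable Q → ∀ b →
  (∃[ t ] Q t × (∀ {t′} → t < t′ → t′ < b → ¬ Q t′)) ⊎ (∀ {t} → t < b → ¬ Q t)
largest Q? zero = inj₂ λ ()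
largest Q? (suc b) with Q? b | largest Q? b
... | yes q | _                     = inj₁ (b , q , λ b<t t<1+b → contradiction t<1+b (≤⇒≯ b<t))
... | no ¬q | inj₁ (t , q , max)    =
  inj₁ (t , q , λ {t′} t<t′ t′<1+b q′ → [ (λ t′<b → max t<t′ t′<b q′) , (λ { refl → ¬q q′ }) ]′ (m≤n⇒m<n∨m≡n (s≤s⁻¹ t′<1+b)))
... | no ¬q | inj₂ none             =
  inj₂ λ {t} t<1+b q → [ (λ t<b → none t<b q) , (λ { refl → ¬q q }) ]′ (m≤n⇒m<n∨m≡n (s≤s⁻¹ t<1+b))

argmax : ∀ {A : Set} (h : A → ℕ) xs → xs ≡ [] ⊎ (∃[ x ] x ∈ xs × (∀ {y} → y ∈ xs → h y ≤ h x))
argmax h [] = inj₁ refl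
argmax h (x ∷ xs) with argmax h xs
... | inj₁ refl = inj₂ (x , here refl , λ { (here refl) → ≤-refl })
... | inj₂ (y , y∈ , max) with ≤-total (h x) (h y)
...   | inj₁ x≤y = inj₂ (y , there y∈ , λ { (here refl) → x≤y ; (there z∈) → max z∈ })
...   | inj₂ y≤x = inj₂ (x , here refl , λ { (here refl) → ≤-refl ; (there z∈) → ≤-trans (max z∈) y≤x })

-- Positions of the game and Bob's invariant.

module Game {A K : Set} (class : A → K) where
  open Nat using (_+_)

  -- Stands in for independence: in the graph, vertices of one class will be pairwise non-adjacent.
  Homogeneous : List A → Set
  Homogeneous B = ∀ {u v} → u ∈ B → v ∈ B → class u ≡ class v

  Covered : List (List A) → List (Block A) → List (Block A) → A → Set
  Covered Ps Ss Bs v = Any (v ∈_) Ps ⊎ Any (λ b → v ∈ proj₂ b) Ss ⊎ Any (λ b → v ∈ proj₂ b) Bs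

  -- Coloured vertices may remain in the lists and vertices may be repeated: the lists need only
  -- cover the uncoloured vertices.
  record Invariant (g : A → ℕ) (Ps : List (List A)) (Ss Bs : List (Block A)) : Set where
    field
      large   : ∀ {P} → P ∈ Ps → 2 ≤ length P
      dense   : ∀ {P S} → P ∈ Ps → S ⊆ P →
                demand Ps Ss Bs (length S) ≤ sum (map g S) + discount (length S) (length P)
      rankedS : Ranked g (λ _ → level 0 Ps) Ss
      rankedB : Ranked g (λ τ → level (suc τ) Ps + size Ss) Bs
      sorted  : AllPairs (λ x y → proj₁ y ≤ proj₁ x) Bs
      classP  : ∀ {P} → P ∈ Ps → Homogeneous P
      classS  : All (Homogeneous ∘ proj₂) Ss
      classB  : All (Homogeneous ∘ proj₂) Bs

  ranked-positive : ∀ {g : A → ℕ} {b v} Bs → Ranked g b Bs → Any (λ c → v ∈ proj₂ c) Bs → 0 < g v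
  ranked-positive (_ ∷ _)  (rB , _) (here v∈B)   = ≤-<-trans z≤n (All.lookup rB v∈B)
  ranked-positive (_ ∷ Bs) (_ , r)  (there v∈Bs) = ranked-positive Bs r v∈Bs

  -- The case of one vertex in `dense`, where the discount vanishes.
  level-vertex : ∀ {g Ps Ss Bs} → Invariant g Ps Ss Bs → ∀ {P v} → P ∈ Ps → v ∈ P → level 0 Ps ≤ g v
  level-vertex {g} {Ps} inv {P} {v} P∈ v∈ = begin
    level 0 Ps                                ≤⟨ dense P∈ (Sublist.from∈ v∈) ⟩
    g v + 0 + discount 1 (length P)           ≡⟨ cong₂ _+_ (+-identityʳ (g v)) (discount-1 (length P)) ⟩
    g v + 0                                   ≡⟨ +-identityʳ (g v) ⟩
    g v                                       ∎
    where
    open Invariant inv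
    open ≤-Reasoning

  positive : ∀ {g Ps Ss Bs v} → Invariant g Ps Ss Bs → Covered Ps Ss Bs v → 0 < g v
  positive {Ps = _ ∷ _} inv (inj₁ v∈Ps) =
    let (P , P∈ , v∈) = find v∈Ps in <-≤-trans z<s (level-vertex inv P∈ v∈)
  positive {Ss = Ss} inv (inj₂ (inj₁ v∈)) = ranked-positive Ss (Invariant.rankedS inv) v∈
  positive {Bs = Bs} inv (inj₂ (inj₂ v∈)) = ranked-positive Bs (Invariant.rankedB inv) v∈

  -- The order looks at types only, so the vertices of a block can be exchanged.
  sorted-replace : ∀ Bs {τ B B′} {Cs : List (Block A)} →
    AllPairs (λ x y → proj₁ y ≤ proj₁ x) (Bs ++ (τ , B) ∷ Cs) →
    AllPairs (λ x y → proj₁ y ≤ proj₁ x) (Bs ++ (τ , B′) ∷ Cs)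
  sorted-replace []       (τ≥ ∷ s) = τ≥ ∷ s
  sorted-replace (b ∷ Bs) (b≥ ∷ s) with All.++⁻ Bs b≥
  ... | b≥Bs , b≥τ ∷ b≥Cs = All.++⁺ b≥Bs (b≥τ ∷ b≥Cs) ∷ sorted-replace Bs s

  sorted-tail : ∀ Bs {c} {Cs : List (Block A)} →
    AllPairs (λ x y → proj₁ y ≤ proj₁ x) (Bs ++ c ∷ Cs) → All (λ y → proj₁ y ≤ proj₁ c) Cs
  sorted-tail []       (c≥ ∷ _) = c≥
  sorted-tail (b ∷ Bs) (_ ∷ s)  = sorted-tail Bs s

  -- The new block goes behind those of equal type. The blocks behind it then have strictly smaller
  -- type, which is what lets them wait for it as well.
  sorted-insert : ∀ τ R {Bs : List (Block A)} → AllPairs (λ x y → proj₁ y ≤ proj₁ x) Bs → ∃[ Cs ] ∃[ Ds ]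
    Bs ≡ Cs ++ Ds × All (λ b → τ ≤ proj₁ b) Cs × All (λ b → proj₁ b < τ) Ds ×
    AllPairs (λ x y → proj₁ y ≤ proj₁ x) (Cs ++ (τ , R) ∷ Ds)
  sorted-insert τ R [] = [] , [] , refl , [] , [] , [] ∷ []
  sorted-insert τ R {b ∷ Bs} (b≥ ∷ s) with τ ≤? proj₁ b | sorted-insert τ R s
  ... | no τ≰b  | _ = [] , b ∷ Bs , refl , [] , ≰⇒> τ≰b ∷ All.map (λ le → ≤-<-trans le (≰⇒> τ≰b)) b≥ ,
                      (<⇒≤ (≰⇒> τ≰b) ∷ All.map (λ le → ≤-trans le (<⇒≤ (≰⇒> τ≰b))) b≥) ∷ b≥ ∷ s
  ... | yes τ≤b | Cs , Ds , refl , τ≤Cs , Ds<τ , s′ =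
    b ∷ Cs , Ds , refl , τ≤b ∷ τ≤Cs , Ds<τ ,
    All.++⁺ (All.++⁻ˡ Cs b≥) (τ≤b ∷ All.++⁻ʳ Cs b≥) ∷ s′

  -- The effect of one round of marks.

  module Round {M : Pred A 0ℓ} (M? : Decidable M) where

    mk : A → ℕ
    mk v with M? v
    ... | yes _ = 1
    ... | no  _ = 0

    mk≤1 : ∀ v → mk v ≤ 1
    mk≤1 v with M? v
    ... | yes _ = ≤-refl
    ... | no  _ = z≤n

    mk-marked : ∀ {v} → M v → mk v ≡ 1
    mk-marked {v} m with M? v
    ... | yes _ = refl
    ... | no ¬m = contradiction m ¬m

    mk-unmarked : ∀ {v} → ¬ M v → mk v ≡ 0
    mk-unmarked {v} ¬m with M? v
    ... | yes m = contradiction m ¬m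
    ... | no _  = refl

    marks : List A → ℕ
    marks S = sum (map mk S)

    rest : List A → List A
    rest = filter (¬? ∘ M?)

    rest+marks : ∀ S → length (rest S) + marks S ≡ length S
    rest+marks [] = refl
    rest+marks (x ∷ S) with M? x
    ... | yes _ = trans (+-suc (length (rest S)) (marks S)) (cong suc (rest+marks S))
    ... | no  _ = cong suc (rest+marks S)

    ∈rest⁻ : ∀ {v} S → v ∈ rest S → v ∈ S × ¬ M v
    ∈rest⁻ S = ∈-filter⁻ (¬? ∘ M?) {xs = S}

    marks-⊆ : ∀ {S P} → S ⊆ P → marks S ≤ marks P
    marks-⊆ []             = z≤n
    marks-⊆ (y ∷ʳ S⊆P)     = ≤-trans (marks-⊆ S⊆P) (m≤n+m _ (mk y))
    marks-⊆ (_∷_ {x} refl S⊆P) = +-monoʳ-≤ (mk x) (marks-⊆ S⊆P)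

    marks-all : ∀ {S} → All M S → marks S ≡ length S
    marks-all []       = refl
    marks-all (m ∷ mS) = cong₂ _+_ (mk-marked m) (marks-all mS)

    marks-none : ∀ {S} → All (∁ M) S → marks S ≡ 0
    marks-none []         = refl
    marks-none (¬m ∷ ¬mS) = cong₂ _+_ (mk-unmarked ¬m) (marks-none ¬mS)

    marks-any : ∀ {S} → Any M S → 1 ≤ marks S
    marks-any {x ∷ S} (here m) = ≤-trans (≤-reflexive (sym (mk-marked m))) (m≤m+n (mk x) (marks S))
    marks-any {x ∷ S} (there a) = ≤-trans (marks-any a) (m≤n+m (marks S) (mk x))

    marks⇒any : ∀ S → 1 ≤ marks S → Any M S
    marks⇒any S 1≤ with Any.any? M? S
    ... | yes a = a
    ... | no ¬a = contradiction (≤-trans 1≤ (≤-reflexive (marks-none (All.¬Any⇒All¬ S ¬a)))) λ ()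

    marks≤length : ∀ S → marks S ≤ length S
    marks≤length []      = z≤n
    marks≤length (x ∷ S) = +-mono-≤ (mk≤1 x) (marks≤length S)

    -- The dichotomy behind the uses of slack: a set with an unmarked vertex loses at least one unit
    -- less than its size, so only fully marked sets need a strict inequality.
    all-or-fewer : ∀ S → All M S ⊎ marks S < length S
    all-or-fewer [] = inj₁ []
    all-or-fewer (x ∷ S) with M? x | all-or-fewer S
    ... | no _  | _       = inj₂ (s≤s (marks≤length S))
    ... | yes m | inj₁ mS = inj₁ (m ∷ mS)
    ... | yes _ | inj₂ <S = inj₂ (s≤s <S)

    first-marked : ∀ (Bs : List (Block A)) → All (λ b → All (∁ M) (proj₂ b)) Bs ⊎
      (∃[ Cs ] ∃[ τ ] ∃[ B ] ∃[ Ds ] Bs ≡ Cs ++ (τ , B) ∷ Ds × All (λ b → All (∁ M) (proj₂ b)) Cs × Any M B)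
    first-marked [] = inj₁ []
    first-marked ((τ , B) ∷ Bs) with Any.any? M? B | first-marked Bs
    ... | yes a | _ = inj₂ ([] , τ , B , Bs , refl , [] , a)
    ... | no ¬a | inj₁ none = inj₁ (All.¬Any⇒All¬ B ¬a ∷ none)
    ... | no ¬a | inj₂ (Cs , σ , C , Ds , eq , none , a) =
      inj₂ ((τ , B) ∷ Cs , σ , C , Ds , cong ((τ , B) ∷_) eq , All.¬Any⇒All¬ B ¬a ∷ none , a)

    -- Carrying inequalities from the allowances `g` before the round to `g′` after it.

    module _ {g g′ : A → ℕ} (g≤ : ∀ v → g v ≤ mk v + g′ v) where

      unmarked-≤ : ∀ {v} → ¬ M v → g v ≤ g′ v
      unmarked-≤ {v} ¬m = subst (λ z → g v ≤ z + g′ v) (mk-unmarked ¬m) (g≤ v)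

      transfer : ∀ S → sum (map g S) ≤ marks S + sum (map g′ S)
      transfer []      = z≤n
      transfer (x ∷ S) = ≤-trans (+-mono-≤ (g≤ x) (transfer S))
        (≤-reflexive (eq (mk x) (g′ x) (marks S) (sum (map g′ S))))
        where
        eq : ∀ w x y z → (w + x) + (y + z) ≡ (w + y) + (x + z)
        eq = solve-∀

      -- The allowances in `S` fall by at most `marks S` in total, and the drop `d` of the demand
      -- pays for that.
      keep : ∀ S {W W′ d o} → W′ + d ≤ W → marks S ≤ d → W ≤ sum (map g S) + o → W′ ≤ sum (map g′ S) + o
      keep S {W} {W′} {d} {o} drop a≤d W≤ = +-cancelʳ-≤ (marks S) W′ (sum (map g′ S) + o) (begin
        W′ + marks S                       ≤⟨ +-monoʳ-≤ W′ a≤d ⟩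
        W′ + d                             ≤⟨ drop ⟩
        W                                  ≤⟨ W≤ ⟩
        sum (map g S) + o                  ≤⟨ +-monoˡ-≤ o (transfer S) ⟩
        (marks S + sum (map g′ S)) + o     ≡⟨ eq (marks S) (sum (map g′ S)) o ⟩
        (sum (map g′ S) + o) + marks S     ∎)
        where
        open ≤-Reasoning
        eq : ∀ x y z → (x + y) + z ≡ (y + z) + x
        eq = solve-∀

      -- The strict inequality is worth one unit, so one mark beyond the drop is absorbed.
      keep-slack : ∀ S {W W′ d o} → W′ + d ≤ W → marks S ≤ suc d → W < sum (map g S) + o →
                   W′ ≤ sum (map g′ S) + o
      keep-slack S {W} {W′} {d} drop a≤ W< =
        keep S (≤-trans (≤-reflexive (+-suc W′ d)) (s≤s drop)) a≤ W<

      -- The blocks keep their sizes, so only the base has to fall, and only at the marked vertices.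
      ranked-step : ∀ Bs {b b′} → Ranked g b Bs →
        All (λ c → ∀ {u} → u ∈ proj₂ c → mk u + b′ (proj₁ c) ≤ b (proj₁ c)) Bs → Ranked g′ b′ Bs
      ranked-step [] _ _ = tt
      ranked-step ((τ , B) ∷ Bs) {b} {b′} (rB , r) (le ∷ les) =
        All.tabulate (λ {u} u∈B → +-cancelˡ-< (mk u) (b′ τ) (g′ u)
          (≤-<-trans (le u∈B) (<-≤-trans (All.lookup rB u∈B) (g≤ u)))) ,
        ranked-step Bs r (All.map (λ {c} le′ {u} u∈ → ≤-trans
          (≤-reflexive (eq (mk u) (length B) (b′ (proj₁ c)))) (+-monoʳ-≤ (length B) (le′ u∈))) les)
        where
        eq : ∀ x y z → x + (y + z) ≡ y + (x + z)
        eq = solve-∀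

      ranked-unmarked : ∀ Bs {b b′} → Ranked g b Bs → All (λ c → All (∁ M) (proj₂ c)) Bs →
        (∀ τ → b′ τ ≤ b τ) → Ranked g′ b′ Bs
      ranked-unmarked Bs {b} {b′} r none b′≤b = ranked-step Bs r
        (All.map (λ {c} no {u} u∈ → subst (λ z → z + b′ (proj₁ c) ≤ b (proj₁ c))
                                  (sym (mk-unmarked (All.lookup no u∈))) (b′≤b (proj₁ c))) none)

      -- The base is unchanged. The blocks in front and the remainder of the served block are
      -- unmarked, and for the blocks behind it the served block has lost a vertex, which pays for a
      -- mark.
      ranked-serve : ∀ Cs {b τ B Ds} → Ranked g b (Cs ++ (τ , B) ∷ Ds) →
        All (λ c → All (∁ M) (proj₂ c)) Cs → Any M B → Ranked g′ b (Cs ++ (τ , rest B) ∷ Ds)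
      ranked-serve Cs {b} {τ} {B} {Ds} r none a =
        let (rCs , rB , rDs) = ranked-++⁻ Cs r in
        ranked-++⁺ Cs (ranked-unmarked Cs rCs none (λ _ → ≤-refl))
          (All.tabulate (λ u∈ → let (u∈B , ¬m) = ∈rest⁻ B u∈ in
             <-≤-trans (All.lookup rB u∈B) (unmarked-≤ ¬m)) ,
           ranked-step Ds rDs (All.universal (λ c {u} _ → begin
             mk u + (length (rest B) + (size Cs + b (proj₁ c)))     ≡⟨ +-assoc (mk u) _ _ ⟨
             mk u + length (rest B) + (size Cs + b (proj₁ c))       ≤⟨ +-monoˡ-≤ _ (shorter u) ⟩
             length B + (size Cs + b (proj₁ c))                     ∎) Ds))
        where
        open ≤-Reasoning
        shorter : ∀ u → mk u + length (rest B) ≤ length B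
        shorter u = begin
          mk u + length (rest B)       ≤⟨ +-monoˡ-≤ _ (≤-trans (mk≤1 u) (marks-any a)) ⟩
          marks B + length (rest B)    ≡⟨ +-comm (marks B) _ ⟩
          length (rest B) + marks B    ≡⟨ rest+marks B ⟩
          length B                     ∎

-- Bob's replies in a single round.

module Response {A K : Set} (class : A → K) {M : Pred A 0ℓ} (M? : Decidable M)
                {g g′ : A → ℕ} (g≤ : ∀ v → g v ≤ Game.Round.mk class M? v Nat.+ g′ v) where

  open Nat using (_+_)
  open Game class
  open Round M?

  -- Only the marked members of `coloured` receive the colour, so whole parts and blocks can be
  -- named here. `nonempty` guarantees that some vertex is coloured.
  record Reply (Ps : List (List A)) (Ss Bs : List (Block A)) : Set where
    constructor reply
    field
      {Ps′}     : List (List A)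
      {Ss′ Bs′} : List (Block A)
      coloured  : List A
      coherent  : Homogeneous coloured
      nonempty  : Any M coloured
      invariant : Invariant g′ Ps′ Ss′ Bs′
      covers    : ∀ {v} → Covered Ps Ss Bs v → ¬ (M v × v ∈ coloured) → Covered Ps′ Ss′ Bs′ v

  Slack : List (List A) → List (Block A) → List (Block A) → ℕ → Set
  Slack Ps Ss Bs t = ∀ {P S} → P ∈ Ps → S ⊆ P → All M S → t < length S →
    demand Ps Ss Bs (length S) < sum (map g S) + discount (length S) (length P)

  ∑-one : ∀ s → ∑ s (λ _ → 1) ≡ s
  ∑-one zero    = refl
  ∑-one (suc s) = trans (+-comm (∑ s (λ _ → 1)) 1) (cong suc (∑-one s))

  -- Counts the levels, shifted down by one, at which serving a block of type τ lowers the demand.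
  ∑-ifType : ∀ τ n → n ⊓ suc τ ≤ ∑ n (λ i → ifType i τ 1)
  ∑-ifType τ zero = z≤n
  ∑-ifType τ (suc n) with n ≤? τ
  ... | yes n≤τ = ≤-trans (m⊓n≤m (suc n) (suc τ)) (≤-trans (s≤s (⊓-glb ≤-refl (m≤n⇒m≤1+n n≤τ)))
                    (≤-trans (s≤s (∑-ifType τ n)) (≤-reflexive (+-comm 1 _))))
  ... | no n≰τ = ≤-trans (≤-trans (m⊓n≤n (suc n) (suc τ)) (⊓-glb (≰⇒> n≰τ) ≤-refl))
                   (≤-trans (∑-ifType τ n) (m≤m+n _ 0))

  -- The guaranteed drop at level `i` when a tight set of `t` vertices turns its part into a block:
  -- at level `t` the left-over vertices may use up the whole weight of the part.
  skip : ℕ → ℕ → ℕ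
  skip t i with i ≟ t
  ... | yes _ = 0
  ... | no  _ = 1

  skip-≤ : ∀ t i → skip t i ≤ 1
  skip-≤ t i with i ≟ t
  ... | yes _ = z≤n
  ... | no  _ = ≤-refl

  skip-refl : ∀ t → skip t t ≡ 0
  skip-refl t with t ≟ t
  ... | yes _  = refl
  ... | no t≢t = contradiction refl t≢t

  skip-≢ : ∀ {t i} → i ≢ t → skip t i ≡ 1
  skip-≢ {t} {i} i≢t with i ≟ t
  ... | yes i≡t = contradiction i≡t i≢t
  ... | no _    = refl

  ∑-skip-below : ∀ {t} s → s ≤ t → s ≤ ∑ s (skip t)
  ∑-skip-below zero _ = z≤n
  ∑-skip-below {t} (suc s) s<t = ≤-trans (≤-reflexive (+-comm 1 s))
    (+-mono-≤ (∑-skip-below s (<⇒≤ s<t)) (≤-reflexive (sym (skip-≢ (<⇒≢ s<t)))))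

  ∑-skip : ∀ t s → s ≤ suc (∑ s (skip t))
  ∑-skip t zero = z≤n
  ∑-skip t (suc s) with s ≟ t
  ... | yes refl = s≤s (≤-trans (∑-skip-below s ≤-refl) (m≤m+n _ 0))
  ... | no  _    = s≤s (≤-trans (∑-skip t s) (≤-reflexive (+-comm 1 _)))

  -- Serving the first marked single vertex or block.

  covers-rest : ∀ {v} (Cs : List (Block A)) {τ B Ds} → Any (λ b → v ∈ proj₂ b) (Cs ++ (τ , B) ∷ Ds) → ¬ (M v × v ∈ B) →
    Any (λ b → v ∈ proj₂ b) (Cs ++ (τ , rest B) ∷ Ds)
  covers-rest []       (here v∈B)  ¬Mv = here (∈-filter⁺ (¬? ∘ M?) v∈B (λ m → ¬Mv (m , v∈B)))
  covers-rest []       (there v∈)  ¬Mv = there v∈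
  covers-rest (_ ∷ Cs) (here v∈)   ¬Mv = here v∈
  covers-rest (_ ∷ Cs) (there v∈)  ¬Mv = there (covers-rest Cs v∈ ¬Mv)

  homogeneous-rest : ∀ {B} → Homogeneous B → Homogeneous (rest B)
  homogeneous-rest {B} h u∈ v∈ = h (proj₁ (∈rest⁻ B u∈)) (proj₁ (∈rest⁻ B v∈))

  all-rest : ∀ (Cs : List (Block A)) {τ B Ds} → All (Homogeneous ∘ proj₂) (Cs ++ (τ , B) ∷ Ds) →
    All (Homogeneous ∘ proj₂) (Cs ++ (τ , rest B) ∷ Ds)
  all-rest Cs {B = B} h with All.++⁻ Cs h
  ... | hCs , hB ∷ hDs = All.++⁺ hCs (homogeneous-rest {B} hB ∷ hDs)

  size-rest : ∀ Cs {τ B Ds} → size (Cs ++ (τ , rest B) ∷ Ds) + marks B ≡ size (Cs ++ (τ , B) ∷ Ds)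
  size-rest Cs {τ} {B} {Ds} = begin
    size (Cs ++ (τ , rest B) ∷ Ds) + marks B              ≡⟨ cong (_+ marks B) (size-++ Cs _) ⟩
    size Cs + (length (rest B) + size Ds) + marks B       ≡⟨ eq (size Cs) (length (rest B)) (size Ds) (marks B) ⟩
    size Cs + ((length (rest B) + marks B) + size Ds)     ≡⟨ cong (λ z → size Cs + (z + size Ds)) (rest+marks B) ⟩
    size Cs + (length B + size Ds)                        ≡⟨ size-++ Cs _ ⟨
    size (Cs ++ (τ , B) ∷ Ds)                             ∎
    where
    open ≡-Reasoning
    eq : ∀ w x y z → w + (x + y) + z ≡ w + ((x + z) + y)
    eq = solve-∀

  -- Every level except level 0 falls, so the demand of s vertices falls by at least s - 1. This is
  -- enough for sets with an unmarked vertex; fully marked sets use their slack.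
  serve-single : ∀ {Ps Bs} Cs {σ B Ds} → Invariant g Ps (Cs ++ (σ , B) ∷ Ds) Bs →
    Slack Ps (Cs ++ (σ , B) ∷ Ds) Bs 0 →
    All (λ c → All (∁ M) (proj₂ c)) Cs → Any M B → Reply Ps (Cs ++ (σ , B) ∷ Ds) Bs
  serve-single {Ps} {Bs} Cs {σ} {B} {Ds} inv slack none a = reply B
    (All.head (All.++⁻ʳ Cs classS)) a
    record
      { large   = large
      ; dense   = dense′
      ; rankedS = ranked-serve g≤ Cs rankedS none a
      ; rankedB = ranked-step g≤ Bs rankedB (All.universal (λ { (τ , _) {u} _ → rank τ u }) Bs)
      ; sorted  = sorted
      ; classP  = classP
      ; classS  = all-rest Cs classS
      ; classB  = classB
      }
    λ { (inj₁ v∈) _          → inj₁ v∈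
      ; (inj₂ (inj₁ v∈)) ¬Mv → inj₂ (inj₁ (covers-rest Cs v∈ ¬Mv))
      ; (inj₂ (inj₂ v∈)) _   → inj₂ (inj₂ v∈) }
    where
    open Invariant inv
    open ≤-Reasoning
    Ss Ss′ : List (Block A)
    Ss = Cs ++ (σ , B) ∷ Ds
    Ss′ = Cs ++ (σ , rest B) ∷ Ds

    smaller : size Ss′ + 1 ≤ size Ss
    smaller = ≤-trans (+-monoʳ-≤ (size Ss′) (marks-any a)) (≤-reflexive (size-rest Cs))

    rank : ∀ τ u → mk u + (level (suc τ) Ps + size Ss′) ≤ level (suc τ) Ps + size Ss
    rank τ u = begin
      mk u + (level (suc τ) Ps + size Ss′)   ≤⟨ +-monoˡ-≤ _ (mk≤1 u) ⟩
      1 + (level (suc τ) Ps + size Ss′)      ≡⟨ eq (level (suc τ) Ps) (size Ss′) ⟩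
      level (suc τ) Ps + (size Ss′ + 1)      ≤⟨ +-monoʳ-≤ (level (suc τ) Ps) smaller ⟩
      level (suc τ) Ps + size Ss             ∎
      where
      eq : ∀ x y → 1 + (x + y) ≡ x + (y + 1)
      eq = solve-∀

    δ : ℕ → ℕ
    δ zero    = 0
    δ (suc _) = 1

    total-drop : ∀ i → total Ps Ss′ Bs i + δ i ≤ total Ps Ss Bs i
    total-drop zero    = ≤-reflexive (+-identityʳ _)
    total-drop (suc i) = begin
      level (suc i) Ps + (size Ss′ + above i Bs) + 1     ≡⟨ eq (level (suc i) Ps) (size Ss′) (above i Bs) ⟩
      level (suc i) Ps + ((size Ss′ + 1) + above i Bs)   ≤⟨ +-monoʳ-≤ (level (suc i) Ps) (+-monoˡ-≤ (above i Bs) smaller) ⟩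
      level (suc i) Ps + (size Ss + above i Bs)          ∎
      where
      eq : ∀ x y z → x + (y + z) + 1 ≡ x + ((y + 1) + z)
      eq = solve-∀

    demand-drop : ∀ s → demand Ps Ss′ Bs (suc s) + s ≤ demand Ps Ss Bs (suc s)
    demand-drop s = ≤-trans
      (≤-reflexive (cong (demand Ps Ss′ Bs (suc s) +_) (sym (trans (∑-suc s δ) (∑-one s)))))
      (∑-drop (suc s) total-drop)

    dense′ : ∀ {P S} → P ∈ Ps → S ⊆ P →
      demand Ps Ss′ Bs (length S) ≤ sum (map g′ S) + discount (length S) (length P)
    dense′ {S = []} _ _ = z≤n
    dense′ {S = S@(_ ∷ S₀)} P∈ S⊆P with all-or-fewer S
    ... | inj₁ mS = keep-slack g≤ S (demand-drop (length S₀)) (marks≤length S) (slack P∈ S⊆P mS z<s)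
    ... | inj₂ fewer = keep g≤ S (demand-drop (length S₀)) (s≤s⁻¹ fewer) (dense P∈ S⊆P)

  -- The demand of `suc s` vertices falls by at least the minimum of `s` and `suc τ`. No part has
  -- more than `suc τ` marks, so the second term always suffices; the first falls short only for
  -- fully marked sets, by one, and these have slack.
  serve-block : ∀ {Ps Ss} Cs {τ B Ds} → Invariant g Ps Ss (Cs ++ (τ , B) ∷ Ds) →
    Slack Ps Ss (Cs ++ (τ , B) ∷ Ds) 0 → All (λ c → All (∁ M) (proj₂ c)) Ss →
    All (λ c → All (∁ M) (proj₂ c)) Cs → Any M B →
    (∀ {P} → P ∈ Ps → marks P ≤ suc τ) → Reply Ps Ss (Cs ++ (τ , B) ∷ Ds)
  serve-block {Ps} {Ss} Cs {τ} {B} {Ds} inv slack noneS none a few = reply B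
    (All.head (All.++⁻ʳ Cs classB)) a
    record
      { large   = large
      ; dense   = dense′
      ; rankedS = ranked-unmarked g≤ Ss rankedS noneS (λ _ → ≤-refl)
      ; rankedB = ranked-serve g≤ Cs rankedB none a
      ; sorted  = sorted-replace Cs sorted
      ; classP  = classP
      ; classS  = classS
      ; classB  = all-rest Cs classB
      }
    λ { (inj₁ v∈) _          → inj₁ v∈
      ; (inj₂ (inj₁ v∈)) _   → inj₂ (inj₁ v∈)
      ; (inj₂ (inj₂ v∈)) ¬Mv → inj₂ (inj₂ (covers-rest Cs v∈ ¬Mv)) }
    where
    open Invariant inv
    open ≤-Reasoning
    Bs Bs′ : List (Block A)
    Bs = Cs ++ (τ , B) ∷ Ds
    Bs′ = Cs ++ (τ , rest B) ∷ Ds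

    above-drop : ∀ i → above i Bs′ + ifType i τ 1 ≤ above i Bs
    above-drop i = begin
      above i Bs′ + ifType i τ 1
        ≡⟨ cong (_+ ifType i τ 1) (above-++ i Cs _) ⟩
      above i Cs + (ifType i τ (length (rest B)) + above i Ds) + ifType i τ 1
        ≡⟨ eq (above i Cs) (ifType i τ (length (rest B))) (above i Ds) (ifType i τ 1) ⟩
      above i Cs + ((ifType i τ (length (rest B)) + ifType i τ 1) + above i Ds)
        ≤⟨ +-monoʳ-≤ (above i Cs) (+-monoˡ-≤ (above i Ds) (ifType-drop i τ
             (≤-trans (+-monoʳ-≤ (length (rest B)) (marks-any a)) (≤-reflexive (rest+marks B))))) ⟩
      above i Cs + (ifType i τ (length B) + above i Ds)
        ≡⟨ above-++ i Cs _ ⟨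
      above i Bs  ∎
      where
      eq : ∀ w x y z → w + (x + y) + z ≡ w + ((x + z) + y)
      eq = solve-∀

    δ : ℕ → ℕ
    δ zero    = 0
    δ (suc i) = ifType i τ 1

    total-drop : ∀ i → total Ps Ss Bs′ i + δ i ≤ total Ps Ss Bs i
    total-drop zero    = ≤-reflexive (+-identityʳ _)
    total-drop (suc i) = begin
      level (suc i) Ps + (size Ss + above i Bs′) + ifType i τ 1
        ≡⟨ eq (level (suc i) Ps) (size Ss) (above i Bs′) (ifType i τ 1) ⟩
      level (suc i) Ps + (size Ss + (above i Bs′ + ifType i τ 1))
        ≤⟨ +-monoʳ-≤ (level (suc i) Ps) (+-monoʳ-≤ (size Ss) (above-drop i)) ⟩
      level (suc i) Ps + (size Ss + above i Bs)  ∎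
      where
      eq : ∀ w x y z → w + (x + y) + z ≡ w + (x + (y + z))
      eq = solve-∀

    demand-drop : ∀ s → demand Ps Ss Bs′ (suc s) + s ⊓ suc τ ≤ demand Ps Ss Bs (suc s)
    demand-drop s = ≤-trans
      (+-monoʳ-≤ (demand Ps Ss Bs′ (suc s)) (≤-trans (∑-ifType τ s) (≤-reflexive (sym (∑-suc s δ)))))
      (∑-drop (suc s) total-drop)

    dense′ : ∀ {P S} → P ∈ Ps → S ⊆ P →
      demand Ps Ss Bs′ (length S) ≤ sum (map g′ S) + discount (length S) (length P)
    dense′ {S = []} _ _ = z≤n
    dense′ {S = S@(_ ∷ S₀)} P∈ S⊆P with all-or-fewer S
    ... | inj₂ fewer = keep g≤ S (demand-drop (length S₀))
      (⊓-glb (s≤s⁻¹ fewer) (≤-trans (marks-⊆ S⊆P) (few P∈))) (dense P∈ S⊆P)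
    ... | inj₁ mS = keep-slack g≤ S (demand-drop (length S₀))
      (≤-trans (≤-reflexive (marks-all mS)) (s≤s (⊓-glb ≤-refl
        (≤-trans (n≤1+n _) (≤-trans (≤-reflexive (sym (marks-all mS))) (≤-trans (marks-⊆ S⊆P) (few P∈)))))))
      (slack P∈ S⊆P mS z<s)

  -- Turning a part with a tight set into a block.

  module _ (Q : List A) where

    -- Colouring `Q` removes more than `suc i` vertices, while its weight at level `suc i` is at
    -- least its size less `suc i`. So the weight holds the left-over vertices and one unit more.
    room : ∀ {i} → suc i < marks Q → length (rest Q) + 1 ≤ weight (suc i) (length Q)
    room {i} i<j = +-cancelˡ-≤ (suc i) _ _ (begin
      suc i + (length (rest Q) + 1)      ≡⟨ eq i (length (rest Q)) ⟩
      length (rest Q) + suc (suc i)      ≤⟨ +-monoʳ-≤ (length (rest Q)) i<j ⟩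
      length (rest Q) + marks Q          ≡⟨ rest+marks Q ⟩
      length Q                           ≤⟨ weight-lower i (length Q) ⟩
      suc i + weight (suc i) (length Q)  ∎)
      where
      open ≤-Reasoning
      eq : ∀ i r → suc i + (r + 1) ≡ r + suc (suc i)
      eq = solve-∀

    room-≤ : ∀ {i} → suc i ≤ marks Q → length (rest Q) ≤ weight (suc i) (length Q)
    room-≤ {i} i<j = +-cancelˡ-≤ (suc i) _ _ (begin
      suc i + length (rest Q)            ≡⟨ +-comm (suc i) _ ⟩
      length (rest Q) + suc i            ≤⟨ +-monoʳ-≤ (length (rest Q)) i<j ⟩
      length (rest Q) + marks Q          ≡⟨ rest+marks Q ⟩
      length Q                           ≤⟨ weight-lower i (length Q) ⟩
      suc i + weight (suc i) (length Q)  ∎)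
      where open ≤-Reasoning

  -- At every level the weight of `Q` makes room for its left-over vertices, with a unit to spare
  -- except possibly at level `suc τ`. Maximality of the tight set enters as slack for the larger
  -- marked sets.
  convert : ∀ {Ps Ss} Cs {Ds τ Q S} → Invariant g Ps Ss (Cs ++ Ds) → Slack Ps Ss (Cs ++ Ds) (suc τ) →
    Q ∈ Ps → S ⊆ Q → All M S → length S ≡ suc τ →
    sum (map g S) + discount (suc τ) (length Q) ≤ demand Ps Ss (Cs ++ Ds) (suc τ) →
    All (λ b → τ ≤ proj₁ b) Cs → All (λ b → proj₁ b < τ) Ds →
    AllPairs (λ x y → proj₁ y ≤ proj₁ x) (Cs ++ (τ , rest Q) ∷ Ds) → Reply Ps Ss (Cs ++ Ds)
  convert {Ps} {Ss} Cs {Ds} {τ} {Q} {S} inv slack Q∈ S⊆Q mS lenS tight τ≤Cs Ds<τ sorted′ with remove Q∈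
  ... | Ps₀ , level-Ps , Ps₀⊆Ps , Ps⊆ = reply Q (classP Q∈) (marks⇒any Q (≤-trans (s≤s z≤n) τ<j))
    record
      { large   = large ∘ Ps₀⊆Ps
      ; dense   = dense′
      ; rankedS = ranked-step g≤ Ss rankedS (All.universal (λ _ {u} _ → ≤-trans
                    (+-monoˡ-≤ (level 0 Ps₀) (mk≤1 u)) (≤-reflexive (sym (level-Ps 0)))) Ss)
      ; rankedB = let (rCs , rDs) = ranked-++⁻ Cs rankedB in
                  ranked-++⁺ Cs (ranked-step g≤ Cs rCs (All.universal (λ { (σ , _) {u} _ → rankCs σ u }) Cs))
                    (All.tabulate (λ u∈ → rankR u∈) ,
                     ranked-step g≤ Ds rDs (All.map (λ {c} σ<τ {u} _ → rankDs (proj₁ c) u σ<τ) Ds<τ))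
      ; sorted  = sorted′
      ; classP  = classP ∘ Ps₀⊆Ps
      ; classS  = classS
      ; classB  = let (hCs , hDs) = All.++⁻ Cs classB in
                  All.++⁺ hCs (homogeneous-rest {Q} (classP Q∈) ∷ hDs)
      }
    covers′
    where
    open Invariant inv
    open ≤-Reasoning
    Bs Bs′ : List (Block A)
    Bs = Cs ++ Ds
    Bs′ = Cs ++ (τ , rest Q) ∷ Ds
    q r : ℕ
    q = length Q
    r = length (rest Q)

    covers′ : ∀ {v} → Covered Ps Ss Bs v → ¬ (M v × v ∈ Q) → Covered Ps₀ Ss Bs′ v
    covers′ (inj₁ v∈Ps) ¬Mv with find v∈Ps
    ... | P , P∈ , v∈P with Ps⊆ P∈
    ...   | inj₂ P∈₀  = inj₁ (lose P∈₀ v∈P)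
    ...   | inj₁ refl = inj₂ (inj₂ (Any.++⁺ʳ Cs (here (∈-filter⁺ (¬? ∘ M?) v∈P (λ m → ¬Mv (m , v∈P))))))
    covers′ (inj₂ (inj₁ v∈)) _ = inj₂ (inj₁ v∈)
    covers′ (inj₂ (inj₂ v∈)) _ = inj₂ (inj₂ ([ Any.++⁺ˡ , Any.++⁺ʳ Cs ∘ there ]′ (Any.++⁻ Cs v∈)))

    τ<j : suc τ ≤ marks Q
    τ<j = ≤-trans (≤-reflexive (sym (trans (marks-all mS) lenS))) (marks-⊆ S⊆Q)

    -- Blocks in front of the new one do not wait for it; the weight of `Q` that they no longer wait
    -- for is at least one and pays for a mark.
    rankCs : ∀ σ u → mk u + (level (suc σ) Ps₀ + size Ss) ≤ level (suc σ) Ps + size Ss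
    rankCs σ u = begin
      mk u + (level (suc σ) Ps₀ + size Ss)              ≤⟨ +-monoˡ-≤ _ (≤-trans (mk≤1 u) (weight-pos (suc σ) q)) ⟩
      weight (suc σ) q + (level (suc σ) Ps₀ + size Ss)  ≡⟨ +-assoc (weight (suc σ) q) _ _ ⟨
      weight (suc σ) q + level (suc σ) Ps₀ + size Ss    ≡⟨ cong (_+ size Ss) (level-Ps (suc σ)) ⟨
      level (suc σ) Ps + size Ss                        ∎

    -- Blocks behind the new one also wait for its vertices, but their type is below τ, so `room`
    -- still leaves a unit for a mark.
    rankDs : ∀ σ u → σ < τ → mk u + (r + (size Cs + (level (suc σ) Ps₀ + size Ss))) ≤
                             size Cs + (level (suc σ) Ps + size Ss)
    rankDs σ u σ<τ = begin
      mk u + (r + (size Cs + (level (suc σ) Ps₀ + size Ss)))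
        ≤⟨ +-monoˡ-≤ _ (mk≤1 u) ⟩
      1 + (r + (size Cs + (level (suc σ) Ps₀ + size Ss)))
        ≡⟨ eq r (size Cs) (level (suc σ) Ps₀) (size Ss) ⟩
      size Cs + ((r + 1) + level (suc σ) Ps₀ + size Ss)
        ≤⟨ +-monoʳ-≤ (size Cs) (+-monoˡ-≤ (size Ss) (+-monoˡ-≤ (level (suc σ) Ps₀)
             (room Q (≤-trans (s≤s σ<τ) τ<j)))) ⟩
      size Cs + (weight (suc σ) q + level (suc σ) Ps₀ + size Ss)
        ≡⟨ cong (λ z → size Cs + (z + size Ss)) (level-Ps (suc σ)) ⟨
      size Cs + (level (suc σ) Ps + size Ss)  ∎
      where
      eq : ∀ w x y z → 1 + (w + (x + (y + z))) ≡ x + ((w + 1) + y + z)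
      eq = solve-∀

    -- Adding an unmarked vertex u to the tight set S leaves g u to pay for level suc τ alone.
    rankR : ∀ {u} → u ∈ rest Q → size Cs + (level (suc τ) Ps₀ + size Ss) < g′ u
    rankR {u} u∈ with ∈rest⁻ Q u∈
    ... | u∈Q , ¬m with insert g S⊆Q mS u∈Q ¬m
    ...   | S⁺ , S⁺⊆Q , len , sm = <-≤-trans (+-cancelʳ-≤ (discount (suc (suc τ)) q) _ _ (begin
      suc (size Cs + (level (suc τ) Ps₀ + size Ss)) + discount (suc (suc τ)) q
        ≡⟨ eq₁ (size Cs) (level (suc τ) Ps₀) (size Ss) (discount (suc (suc τ)) q) ⟩
      suc (discount (suc (suc τ)) q) + (level (suc τ) Ps₀ + (size Ss + size Cs))
        ≤⟨ +-monoˡ-≤ _ (discount-weight τ τ+2≤q) ⟩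
      weight (suc τ) q + discount (suc τ) q + (level (suc τ) Ps₀ + (size Ss + size Cs))
        ≤⟨ +-monoʳ-≤ (weight (suc τ) q + discount (suc τ) q) (+-monoʳ-≤ (level (suc τ) Ps₀)
             (+-monoʳ-≤ (size Ss) above-Cs)) ⟩
      weight (suc τ) q + discount (suc τ) q + (level (suc τ) Ps₀ + (size Ss + above τ Bs))
        ≡⟨ eq₂ (weight (suc τ) q) (discount (suc τ) q) (level (suc τ) Ps₀) (size Ss + above τ Bs) ⟩
      discount (suc τ) q + ((weight (suc τ) q + level (suc τ) Ps₀) + (size Ss + above τ Bs))
        ≡⟨ cong (λ z → discount (suc τ) q + (z + (size Ss + above τ Bs))) (level-Ps (suc τ)) ⟨
      discount (suc τ) q + total Ps Ss Bs (suc τ)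
        ≤⟨ pay ⟩
      g u + discount (suc (suc τ)) q ∎)) (unmarked-≤ g≤ ¬m)
      where
      len′ : length S⁺ ≡ suc (suc τ)
      len′ = trans len (cong suc lenS)
      τ+2≤q : suc (suc τ) ≤ q
      τ+2≤q = ≤-trans (≤-reflexive (sym len′)) (length-mono-≤ S⁺⊆Q)
      above-Cs : size Cs ≤ above τ Bs
      above-Cs = begin
        size Cs                      ≡⟨ above-all τ τ≤Cs ⟨
        above τ Cs                   ≤⟨ m≤m+n _ (above τ Ds) ⟩
        above τ Cs + above τ Ds      ≡⟨ above-++ τ Cs Ds ⟨
        above τ Bs                   ∎
      W : ℕ
      W = demand Ps Ss Bs (suc τ)
      pay : discount (suc τ) q + total Ps Ss Bs (suc τ) ≤ g u + discount (suc (suc τ)) q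
      pay = +-cancelʳ-≤ (sum (map g S)) _ _ (begin
        discount (suc τ) q + total Ps Ss Bs (suc τ) + sum (map g S)
          ≡⟨ eq₃ (discount (suc τ) q) (total Ps Ss Bs (suc τ)) (sum (map g S)) ⟩
        (sum (map g S) + discount (suc τ) q) + total Ps Ss Bs (suc τ)
          ≤⟨ +-monoˡ-≤ _ tight ⟩
        demand Ps Ss Bs (suc (suc τ))
          ≡⟨ cong (demand Ps Ss Bs) len′ ⟨
        demand Ps Ss Bs (length S⁺)
          ≤⟨ dense Q∈ S⁺⊆Q ⟩
        sum (map g S⁺) + discount (length S⁺) q
          ≡⟨ cong₂ (λ y z → y + discount z q) sm len′ ⟩
        g u + sum (map g S) + discount (suc (suc τ)) q
          ≡⟨ eq₄ (g u) (sum (map g S)) (discount (suc (suc τ)) q) ⟩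
        g u + discount (suc (suc τ)) q + sum (map g S)  ∎)
        where
        eq₃ : ∀ x y z → x + y + z ≡ (z + x) + y
        eq₃ = solve-∀
        eq₄ : ∀ x y z → x + y + z ≡ x + z + y
        eq₄ = solve-∀
      eq₁ : ∀ w x y z → suc (w + (x + y)) + z ≡ suc z + (x + (y + w))
      eq₁ = solve-∀
      eq₂ : ∀ w x y z → w + x + (y + z) ≡ x + ((w + y) + z)
      eq₂ = solve-∀

    -- Below τ the block and the spare unit both fit; at τ only the block is claimed to fit; beyond
    -- τ the block no longer counts.
    level-room : ∀ i → ifType i τ r + skip (suc τ) (suc i) ≤ weight (suc i) q
    level-room i with <-cmp i τ
    ... | tri< i<τ _ _ = ≤-trans (+-mono-≤ (ifType-≤ i τ r) (skip-≤ (suc τ) (suc i)))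
                           (room Q (≤-trans (s≤s i<τ) τ<j))
    ... | tri≈ _ refl _ = ≤-trans (≤-reflexive (cong (ifType i τ r +_) (skip-refl (suc τ))))
                           (≤-trans (≤-reflexive (+-identityʳ _)) (≤-trans (ifType-≤ i τ r) (room-≤ Q τ<j)))
    ... | tri> _ _ τ<i = ≤-trans (≤-reflexive (cong (_+ skip (suc τ) (suc i)) (ifType-no r τ<i)))
                           (≤-trans (skip-≤ (suc τ) (suc i)) (weight-pos (suc i) q))

    total-drop : ∀ i → total Ps₀ Ss Bs′ i + skip (suc τ) i ≤ total Ps Ss Bs i
    total-drop zero    = ≤-trans (+-monoʳ-≤ (level 0 Ps₀) (skip-≤ (suc τ) 0))
                          (≤-reflexive (trans (+-comm _ 1) (sym (level-Ps 0))))
    total-drop (suc i) = begin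
      level (suc i) Ps₀ + (size Ss + above i Bs′) + skip (suc τ) (suc i)
        ≡⟨ cong (λ z → level (suc i) Ps₀ + (size Ss + z) + skip (suc τ) (suc i)) (above-++ i Cs _) ⟩
      level (suc i) Ps₀ + (size Ss + (above i Cs + (ifType i τ r + above i Ds))) + skip (suc τ) (suc i)
        ≡⟨ eq (level (suc i) Ps₀) (size Ss) (above i Cs) (ifType i τ r) (above i Ds) (skip (suc τ) (suc i)) ⟩
      (ifType i τ r + skip (suc τ) (suc i)) + (level (suc i) Ps₀ + (size Ss + (above i Cs + above i Ds)))
        ≤⟨ +-monoˡ-≤ _ (level-room i) ⟩
      weight (suc i) q + (level (suc i) Ps₀ + (size Ss + (above i Cs + above i Ds)))
        ≡⟨ +-assoc (weight (suc i) q) _ _ ⟨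
      weight (suc i) q + level (suc i) Ps₀ + (size Ss + (above i Cs + above i Ds))
        ≡⟨ cong₂ (λ y z → y + (size Ss + z)) (level-Ps (suc i)) (above-++ i Cs Ds) ⟨
      level (suc i) Ps + (size Ss + above i Bs)  ∎
      where
      eq : ∀ u v w x y z → u + (v + (w + (x + y))) + z ≡ (x + z) + (u + (v + (w + y)))
      eq = solve-∀

    dense′ : ∀ {P S} → P ∈ Ps₀ → S ⊆ P →
      demand Ps₀ Ss Bs′ (length S) ≤ sum (map g′ S) + discount (length S) (length P)
    -- Level `suc τ`, which may not drop, enters the demand only of sets with more than `suc τ`
    -- vertices. These fall short by at most one.
    dense′ {S = S} P∈ S⊆P with length S ≤? suc τ
    ... | yes s≤t = keep g≤ S (∑-drop (length S) total-drop)
                      (≤-trans (marks≤length S) (∑-skip-below (length S) s≤t)) (dense (Ps₀⊆Ps P∈) S⊆P)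
    ... | no  s≰t with all-or-fewer S
    ...   | inj₁ mS    = keep-slack g≤ S (∑-drop (length S) total-drop)
                           (≤-trans (marks≤length S) (∑-skip (suc τ) (length S)))
                           (slack (Ps₀⊆Ps P∈) S⊆P mS (≰⇒> s≰t))
    ...   | inj₂ fewer = keep g≤ S (∑-drop (length S) total-drop)
                           (s≤s⁻¹ (≤-trans fewer (∑-skip (suc τ) (length S)))) (dense (Ps₀⊆Ps P∈) S⊆P)

  -- Colouring the part with the most marks.

  ∑-drop₂ : ∀ {a b : ℕ → ℕ} {j} → a 0 + a 1 + j ≤ b 0 + b 1 → (∀ i → a (2 + i) ≤ b (2 + i)) →
    ∀ n → ∑ (2 + n) a + j ≤ ∑ (2 + n) b
  ∑-drop₂ drop a≤b zero    = drop
  ∑-drop₂ {a} {b} {j} drop a≤b (suc n) = begin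
    ∑ (2 + n) a + a (2 + n) + j    ≡⟨ eq (∑ (2 + n) a) (a (2 + n)) j ⟩
    ∑ (2 + n) a + j + a (2 + n)    ≤⟨ +-mono-≤ (∑-drop₂ drop a≤b n) (a≤b n) ⟩
    ∑ (2 + n) b + b (2 + n)        ∎
    where
    open ≤-Reasoning
    eq : ∀ x y z → x + y + z ≡ x + z + y
    eq = solve-∀

  -- Levels 0 and 1 together give up `j`, at least the marks in any part, which pays for all sets of
  -- two or more vertices. A single vertex sees level 0 only; it is unmarked or has slack.
  dense-kept : ∀ {Ps Ss Bs} {Ps′ : List (List A)} {Ss′ Bs′ : List (Block A)} {j} → Invariant g Ps Ss Bs → Slack Ps Ss Bs 0 →
    total Ps′ Ss′ Bs′ 0 ≤ total Ps Ss Bs 0 →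
    total Ps′ Ss′ Bs′ 0 + total Ps′ Ss′ Bs′ 1 + j ≤ total Ps Ss Bs 0 + total Ps Ss Bs 1 →
    (∀ i → total Ps′ Ss′ Bs′ (2 + i) ≤ total Ps Ss Bs (2 + i)) →
    (∀ {P} → P ∈ Ps → marks P ≤ j) → ∀ {P S} → P ∈ Ps → S ⊆ P →
    demand Ps′ Ss′ Bs′ (length S) ≤ sum (map g′ S) + discount (length S) (length P)
  dense-kept inv slack drop₀ drop₁ drop₂ few {S = []} P∈ S⊆P = z≤n
  dense-kept inv slack drop₀ drop₁ drop₂ few {S = S@(_ ∷ [])} P∈ S⊆P with all-or-fewer S
  ... | inj₁ mS    = keep-slack g≤ S (≤-trans (≤-reflexive (+-identityʳ _)) drop₀) (marks≤length S) (slack P∈ S⊆P mS z<s)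
  ... | inj₂ fewer = keep g≤ S (≤-trans (≤-reflexive (+-identityʳ _)) drop₀) (s≤s⁻¹ fewer) (Invariant.dense inv P∈ S⊆P)
  dense-kept inv slack drop₀ drop₁ drop₂ few {S = S@(_ ∷ _ ∷ S₀)} P∈ S⊆P =
    keep g≤ S (∑-drop₂ drop₁ drop₂ (length S₀)) (≤-trans (marks-⊆ S⊆P) (few P∈)) (Invariant.dense inv P∈ S⊆P)

  -- Blocks with a marked vertex have a type so small that `room` leaves a unit for the mark.
  Outranked : List A → List (Block A) → Set
  Outranked Q = All (λ c → ∀ {u} → u ∈ proj₂ c → M u → suc (proj₁ c) < marks Q)

  -- At most one vertex is left, and it becomes the first single vertex. It could afford to wait for
  -- all parts including `Q`, which is no longer among them. Levels 0 and 1 counted at least the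
  -- size of `Q` and now count only the left-over vertex, so they give up all the marks.
  shrink-single : ∀ {Ps Ss Bs Q} → Invariant g Ps Ss Bs → Slack Ps Ss Bs 0 →
    All (λ c → All (∁ M) (proj₂ c)) Ss → Q ∈ Ps → 1 ≤ marks Q → (∀ {P} → P ∈ Ps → marks P ≤ marks Q) →
    Outranked Q Bs → length (rest Q) ≤ 1 → Reply Ps Ss Bs
  shrink-single {Ps} {Ss} {Bs} {Q} inv slack none Q∈ 1≤j few outranked r≤1 with remove Q∈
  ... | Ps₀ , level-Ps , Ps₀⊆Ps , Ps⊆ = reply Q (classP Q∈) (marks⇒any Q 1≤j)
    record
      { large   = large ∘ Ps₀⊆Ps
      ; dense   = dense-kept {Ps′ = Ps₀} {Ss′} {Bs} inv slack level₀≤ drop₁ drop₂ few ∘ Ps₀⊆Ps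
      ; rankedS = All.tabulate (λ u∈ → let (u∈Q , ¬m) = ∈rest⁻ Q u∈ in
                    ≤-trans (≤-trans (≤-reflexive (sym (level-Ps 0))) (level-vertex inv Q∈ u∈Q)) (unmarked-≤ g≤ ¬m)) ,
                  ranked-unmarked g≤ Ss rankedS none (λ _ →
                    ≤-trans (+-monoˡ-≤ (level 0 Ps₀) r≤1) (≤-reflexive (sym (level-Ps 0))))
      ; rankedB = ranked-step g≤ Bs rankedB (All.map (λ {c} big {u} u∈ → rankB (proj₁ c) u (big u∈)) outranked)
      ; sorted  = sorted
      ; classP  = classP ∘ Ps₀⊆Ps
      ; classS  = homogeneous-rest {Q} (classP Q∈) ∷ classS
      ; classB  = classB
      }
    covers′
    where
    open Invariant inv
    open ≤-Reasoning
    q r : ℕ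
    q = length Q
    r = length (rest Q)
    Ss′ : List (Block A)
    Ss′ = (0 , rest Q) ∷ Ss

    covers′ : ∀ {v} → Covered Ps Ss Bs v → ¬ (M v × v ∈ Q) → Covered Ps₀ Ss′ Bs v
    covers′ (inj₁ v∈Ps) ¬Mv with find v∈Ps
    ... | P , P∈ , v∈P with Ps⊆ P∈
    ...   | inj₂ P∈₀  = inj₁ (lose P∈₀ v∈P)
    ...   | inj₁ refl = inj₂ (inj₁ (here (∈-filter⁺ (¬? ∘ M?) v∈P (λ m → ¬Mv (m , v∈P)))))
    covers′ (inj₂ (inj₁ v∈)) _ = inj₂ (inj₁ (there v∈))
    covers′ (inj₂ (inj₂ v∈)) _ = inj₂ (inj₂ v∈)

    level₀≤ : level 0 Ps₀ ≤ level 0 Ps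
    level₀≤ = ≤-trans (n≤1+n _) (≤-reflexive (sym (level-Ps 0)))

    drop₁ : total Ps₀ Ss′ Bs 0 + total Ps₀ Ss′ Bs 1 + marks Q ≤ total Ps Ss Bs 0 + total Ps Ss Bs 1
    drop₁ = begin
      level 0 Ps₀ + (level 1 Ps₀ + ((r + size Ss) + above 0 Bs)) + marks Q
        ≡⟨ eq₁ (level 0 Ps₀) (level 1 Ps₀) r (size Ss) (above 0 Bs) (marks Q) ⟩
      (r + marks Q) + (level 0 Ps₀ + (level 1 Ps₀ + (size Ss + above 0 Bs)))
        ≤⟨ +-monoˡ-≤ _ (≤-trans (≤-reflexive (rest+marks Q)) (weight-lower 0 q)) ⟩
      (1 + weight 1 q) + (level 0 Ps₀ + (level 1 Ps₀ + (size Ss + above 0 Bs)))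
        ≡⟨ eq₂ (weight 1 q) (level 0 Ps₀) (level 1 Ps₀) (size Ss + above 0 Bs) ⟩
      (1 + level 0 Ps₀) + ((weight 1 q + level 1 Ps₀) + (size Ss + above 0 Bs))
        ≡⟨ cong₂ (λ y z → y + (z + (size Ss + above 0 Bs))) (level-Ps 0) (level-Ps 1) ⟨
      level 0 Ps + (level 1 Ps + (size Ss + above 0 Bs))  ∎
      where
      eq₁ : ∀ u v w x y z → u + (v + ((w + x) + y)) + z ≡ (w + z) + (u + (v + (x + y)))
      eq₁ = solve-∀
      eq₂ : ∀ w x y z → (1 + w) + (x + (y + z)) ≡ (1 + x) + ((w + y) + z)
      eq₂ = solve-∀

    level-room : ∀ i {x} → x + r ≤ weight (suc i) q →
      x + (level (suc i) Ps₀ + (r + size Ss)) ≤ level (suc i) Ps + size Ss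
    level-room i {x} le = begin
      x + (level (suc i) Ps₀ + (r + size Ss))           ≡⟨ eq x (level (suc i) Ps₀) r (size Ss) ⟩
      (x + r) + level (suc i) Ps₀ + size Ss             ≤⟨ +-monoˡ-≤ (size Ss) (+-monoˡ-≤ (level (suc i) Ps₀) le) ⟩
      weight (suc i) q + level (suc i) Ps₀ + size Ss    ≡⟨ cong (_+ size Ss) (level-Ps (suc i)) ⟨
      level (suc i) Ps + size Ss                        ∎
      where
      eq : ∀ w x y z → w + (x + (y + z)) ≡ (w + y) + x + z
      eq = solve-∀

    drop₂ : ∀ i → total Ps₀ Ss′ Bs (2 + i) ≤ total Ps Ss Bs (2 + i)
    drop₂ i = begin
      level (2 + i) Ps₀ + ((r + size Ss) + above (suc i) Bs)   ≡⟨ +-assoc (level (2 + i) Ps₀) _ _ ⟨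
      level (2 + i) Ps₀ + (r + size Ss) + above (suc i) Bs     ≤⟨ +-monoˡ-≤ _ (level-room (suc i) {0}
                                                                    (≤-trans r≤1 (weight-pos (2 + i) q))) ⟩
      level (2 + i) Ps + size Ss + above (suc i) Bs            ≡⟨ +-assoc (level (2 + i) Ps) _ _ ⟩
      level (2 + i) Ps + (size Ss + above (suc i) Bs)          ∎

    rankB : ∀ τ u → (M u → suc τ < marks Q) →
      mk u + (level (suc τ) Ps₀ + (r + size Ss)) ≤ level (suc τ) Ps + size Ss
    rankB τ u big with M? u
    ... | yes m = level-room τ (≤-trans (≤-reflexive (+-comm 1 r)) (room Q (big m)))
    ... | no  _ = level-room τ (≤-trans r≤1 (weight-pos (suc τ) q))

  -- From two vertices on, the maximum with 1 has no effect at level 1, so levels 0 and 1 together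
  -- count a part by its size. One left-over vertex would count twice, hence the separate treatment
  -- as a single vertex.
  weight-1 : ∀ {r} → 2 ≤ r → weight 1 r + 1 ≤ r
  weight-1 {suc (suc r)} _ = ≤-reflexive (trans (+-comm _ 1) (cong (suc ∘ suc) (⊔-identityʳ r)))
  weight-1 {suc zero} (s≤s ())

  -- The left-over vertices stay a normal part. Level 0 is unchanged, and level 1 alone falls by the
  -- number of marks in `Q`.
  shrink-large : ∀ {Ps Ss Bs Q} → Invariant g Ps Ss Bs → Slack Ps Ss Bs 0 →
    All (λ c → All (∁ M) (proj₂ c)) Ss → Q ∈ Ps → 1 ≤ marks Q → (∀ {P} → P ∈ Ps → marks P ≤ marks Q) →
    Outranked Q Bs → 2 ≤ length (rest Q) → Reply Ps Ss Bs
  shrink-large {Ps} {Ss} {Bs} {Q} inv slack none Q∈ 1≤j few outranked 2≤r with remove Q∈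
  ... | Ps₀ , level-Ps , Ps₀⊆Ps , Ps⊆ = reply Q (classP Q∈) (marks⇒any Q 1≤j)
    record
      { large   = λ { (here refl) → 2≤r ; (there P∈) → large (Ps₀⊆Ps P∈) }
      ; dense   = λ { (here refl) → dense-rest
                    ; (there P∈) → dense-kept {Ps′ = Ps′} {Ss} {Bs} inv slack level₀≤ drop₁ drop₂ few (Ps₀⊆Ps P∈) }
      ; rankedS = ranked-unmarked g≤ Ss rankedS none (λ _ → level₀≤)
      ; rankedB = ranked-step g≤ Bs rankedB (All.map (λ {c} big {u} u∈ → rankB (proj₁ c) u (big u∈)) outranked)
      ; sorted  = sorted
      ; classP  = λ { (here refl) → homogeneous-rest {Q} (classP Q∈) ; (there P∈) → classP (Ps₀⊆Ps P∈) }
      ; classS  = classS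
      ; classB  = classB
      }
    covers′
    where
    open Invariant inv
    open ≤-Reasoning
    q r : ℕ
    q = length Q
    r = length (rest Q)
    Ps′ : List (List A)
    Ps′ = rest Q ∷ Ps₀

    covers′ : ∀ {v} → Covered Ps Ss Bs v → ¬ (M v × v ∈ Q) → Covered Ps′ Ss Bs v
    covers′ (inj₁ v∈Ps) ¬Mv with find v∈Ps
    ... | P , P∈ , v∈P with Ps⊆ P∈
    ...   | inj₂ P∈₀  = inj₁ (there (lose P∈₀ v∈P))
    ...   | inj₁ refl = inj₁ (here (∈-filter⁺ (¬? ∘ M?) v∈P (λ m → ¬Mv (m , v∈P))))
    covers′ (inj₂ v∈) _ = inj₂ v∈

    r≤q : r ≤ q
    r≤q = length-filter (¬? ∘ M?) Q

    level₀≤ : level 0 Ps′ ≤ level 0 Ps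
    level₀≤ = ≤-reflexive (sym (level-Ps 0))

    level-room : ∀ i {x} → x + weight i r ≤ weight i q → x + level i Ps′ ≤ level i Ps
    level-room i {x} le = begin
      x + (weight i r + level i Ps₀)   ≡⟨ +-assoc x _ _ ⟨
      x + weight i r + level i Ps₀     ≤⟨ +-monoˡ-≤ (level i Ps₀) le ⟩
      weight i q + level i Ps₀         ≡⟨ level-Ps i ⟨
      level i Ps                       ∎

    room₁ : marks Q + weight 1 r ≤ weight 1 q
    room₁ = +-cancelˡ-≤ 1 _ _ (begin
      1 + (marks Q + weight 1 r)       ≡⟨ eq (marks Q) (weight 1 r) ⟩
      (weight 1 r + 1) + marks Q       ≤⟨ +-monoˡ-≤ (marks Q) (weight-1 2≤r) ⟩
      r + marks Q                      ≡⟨ rest+marks Q ⟩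
      q                                ≤⟨ weight-lower 0 q ⟩
      1 + weight 1 q                   ∎)
      where
      eq : ∀ x y → 1 + (x + y) ≡ (y + 1) + x
      eq = solve-∀

    drop₁ : total Ps′ Ss Bs 0 + total Ps′ Ss Bs 1 + marks Q ≤ total Ps Ss Bs 0 + total Ps Ss Bs 1
    drop₁ = begin
      level 0 Ps′ + (level 1 Ps′ + (size Ss + above 0 Bs)) + marks Q
        ≡⟨ eq (level 0 Ps′) (level 1 Ps′) (size Ss + above 0 Bs) (marks Q) ⟩
      level 0 Ps′ + ((marks Q + level 1 Ps′) + (size Ss + above 0 Bs))
        ≤⟨ +-mono-≤ level₀≤ (+-monoˡ-≤ _ (level-room 1 room₁)) ⟩
      level 0 Ps + (level 1 Ps + (size Ss + above 0 Bs))  ∎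
      where
      eq : ∀ w x y z → w + (x + y) + z ≡ w + ((z + x) + y)
      eq = solve-∀

    drop₂ : ∀ i → total Ps′ Ss Bs (2 + i) ≤ total Ps Ss Bs (2 + i)
    drop₂ i = +-monoˡ-≤ _ (level-room (2 + i) {0} (weight-mono (2 + i) r≤q))

    rankB : ∀ τ u → (M u → suc τ < marks Q) →
      mk u + (level (suc τ) Ps′ + size Ss) ≤ level (suc τ) Ps + size Ss
    rankB τ u big = ≤-trans (≤-reflexive (sym (+-assoc (mk u) _ _))) (+-monoˡ-≤ (size Ss) (bound (M? u)))
      where
      bound : Dec (M u) → mk u + level (suc τ) Ps′ ≤ level (suc τ) Ps
      bound (yes m) = level-room (suc τ) (begin
        mk u + weight (suc τ) r     ≤⟨ +-mono-≤ (mk≤1 u) (weight-upper (suc τ) (≤-trans (n≤1+n 1) 2≤r)) ⟩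
        1 + r                       ≡⟨ +-comm 1 r ⟩
        r + 1                       ≤⟨ room Q (big m) ⟩
        weight (suc τ) q            ∎)
      bound (no ¬m) = level-room (suc τ) (≤-trans
        (≤-reflexive (cong (_+ weight (suc τ) r) (mk-unmarked ¬m))) (weight-mono (suc τ) r≤q))

    -- Shrinking the part lowers the discount by at most one, which the drop in demand pays for.
    dense-rest : ∀ {S} → S ⊆ rest Q →
      demand Ps′ Ss Bs (length S) ≤ sum (map g′ S) + discount (length S) r
    dense-rest {S} S⊆R = bound S (⊆-trans S⊆R (filter-⊆ (¬? ∘ M?) Q)) (length-mono-≤ S⊆R)
      (≤-reflexive (marks-none (All-resp-⊆ S⊆R (All.all-filter (¬? ∘ M?) Q))))
      where
      bound : ∀ S → S ⊆ Q → length S ≤ r → marks S ≤ 0 →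
        demand Ps′ Ss Bs (length S) ≤ sum (map g′ S) + discount (length S) r
      bound []        _   _   _    = z≤n
      bound S@(_ ∷ []) S⊆Q _  a≤0 = subst (λ z → demand Ps′ Ss Bs 1 ≤ sum (map g′ S) + z)
        (trans (discount-1 q) (sym (discount-1 r)))
        (keep g≤ S (≤-trans (≤-reflexive (+-identityʳ _)) level₀≤) a≤0 (dense Q∈ S⊆Q))
      bound S@(_ ∷ _ ∷ S₀) S⊆Q s≤r a≤0 = +-cancelʳ-≤ 1 _ _ (begin
        demand Ps′ Ss Bs (length S) + 1
          ≤⟨ keep g≤ S drop a≤0 (dense Q∈ S⊆Q) ⟩
        sum (map g′ S) + discount (length S) q
          ≤⟨ +-monoʳ-≤ (sum (map g′ S)) (≤-trans (discount-≤ (length S) q) (discount-suc≤ s≤r)) ⟩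
        sum (map g′ S) + suc (discount (length S) r)
          ≡⟨ eq (sum (map g′ S)) (discount (length S) r) ⟩
        sum (map g′ S) + discount (length S) r + 1  ∎)
        where
        drop : demand Ps′ Ss Bs (length S) + 1 + 0 ≤ demand Ps Ss Bs (length S)
        drop = ≤-trans (≤-reflexive (+-identityʳ _)) (≤-trans (+-monoʳ-≤ (demand Ps′ Ss Bs (length S)) 1≤j)
          (∑-drop₂ drop₁ drop₂ (length S₀)))
        eq : ∀ x y → x + suc y ≡ x + y + 1
        eq = solve-∀

  -- Choosing the reply.

  Tight : List (List A) → List (Block A) → List (Block A) → ℕ → Set
  Tight Ps Ss Bs t = Any (λ P → ∃[ S ] S ⊆ P ×
    (All M S × length S ≡ t × sum (map g S) + discount t (length P) ≤ demand Ps Ss Bs t)) Ps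

  tight? : ∀ Ps Ss Bs → Decidable (Tight Ps Ss Bs)
  tight? Ps Ss Bs t = Any.any? (λ P → anySublist? (λ S →
    All.all? M? S ×-dec (length S ≟ t) ×-dec (sum (map g S) + discount t (length P) ≤? demand Ps Ss Bs t)) P) Ps

  length≤total : ∀ {P Ps} → P ∈ Ps → length P ≤ sum (map (length {A = A}) Ps)
  length≤total {Ps = P ∷ Ps} (here refl) = m≤m+n (length P) _
  length≤total {Ps = P ∷ Ps} (there P∈)  = ≤-trans (length≤total P∈) (m≤n+m _ (length P))

  shrink : ∀ {Ps Ss Bs Q} → Invariant g Ps Ss Bs → Slack Ps Ss Bs 0 →
    All (λ c → All (∁ M) (proj₂ c)) Ss → Q ∈ Ps → 1 ≤ marks Q → (∀ {P} → P ∈ Ps → marks P ≤ marks Q) →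
    Outranked Q Bs → Reply Ps Ss Bs
  shrink {Q = Q} inv slack none Q∈ 1≤j few outranked with length (rest Q) ≤? 1
  ... | yes r≤1 = shrink-single inv slack none Q∈ 1≤j few outranked r≤1
  ... | no  r≰1 = shrink-large inv slack none Q∈ 1≤j few outranked (≰⇒> r≰1)

  outranked-unmarked : ∀ {Q Bs} → All (λ c → All (∁ M) (proj₂ c)) Bs → Outranked Q Bs
  outranked-unmarked = All.map (λ no {u} u∈ mu → contradiction mu (All.lookup no u∈))

  -- The first marked block is passed over only if some part has more marks than its type allows
  -- for. The part with the most marks then outranks this block and, by the order of the types, all
  -- blocks behind it.
  respond-slack : ∀ {Ps Ss Bs v} → Invariant g Ps Ss Bs → Slack Ps Ss Bs 0 →
    Covered Ps Ss Bs v → M v → Reply Ps Ss Bs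
  respond-slack {Ps} {Ss} {Bs} inv slack v∈ m with first-marked Ss
  ... | inj₂ (Cs , σ , B , Ds , refl , none , a) = serve-single Cs inv slack none a
  ... | inj₁ noneS with first-marked Bs | argmax marks Ps
  ...   | inj₁ noneB | best = case-parts v∈ best
    where
    case-parts : Covered Ps Ss Bs _ → (Ps ≡ [] ⊎ (∃[ Q ] Q ∈ Ps × (∀ {P} → P ∈ Ps → marks P ≤ marks Q))) →
      Reply Ps Ss Bs
    case-parts (inj₂ (inj₁ v∈Ss)) _ = let (c , c∈ , v∈c) = find v∈Ss in
      contradiction m (All.lookup (All.lookup noneS c∈) v∈c)
    case-parts (inj₂ (inj₂ v∈Bs)) _ = let (c , c∈ , v∈c) = find v∈Bs in
      contradiction m (All.lookup (All.lookup noneB c∈) v∈c)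
    case-parts (inj₁ v∈Ps) (inj₂ (Q , Q∈ , few)) = let (P , P∈ , v∈P) = find v∈Ps in
      shrink inv slack noneS Q∈ (≤-trans (marks-any (lose v∈P m)) (few P∈)) few (outranked-unmarked {Q} noneB)
    case-parts (inj₁ ()) (inj₁ refl)
  ...   | inj₂ (Cs , τ , B , Ds , refl , none , a) | best with All.all? (λ P → marks P ≤? suc τ) Ps
  ...     | yes few = serve-block Cs inv slack noneS none a (All.lookup few)
  ...     | no ¬few with find (All.¬All⇒Any¬ (λ P → marks P ≤? suc τ) Ps ¬few) | best
  ...       | P , () , P≰ | inj₁ refl
  ...       | P , P∈ , P≰ | inj₂ (Q , Q∈ , few) = shrink inv slack noneS Q∈ (≤-trans (s≤s z≤n) τ<) few
    (All.++⁺ (outranked-unmarked {Q} none)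
      ((λ _ _ → τ<) ∷ All.map (λ σ≤τ {u} _ _ → ≤-<-trans (s≤s σ≤τ) τ<) (sorted-tail Cs (Invariant.sorted inv))))
    where
    τ< : suc τ < marks Q
    τ< = <-≤-trans (≰⇒> P≰) (few P∈)

  -- Sizes are searched in the form `suc τ`, as the empty set is trivially tight. The total length
  -- of the parts bounds the size of every candidate.
  respond : ∀ {Ps Ss Bs v} → Invariant g Ps Ss Bs → Covered Ps Ss Bs v → M v → Reply Ps Ss Bs
  respond {Ps} {Ss} {Bs} inv v∈ m with largest (tight? Ps Ss Bs ∘ suc) (sum (map length Ps))
  ... | inj₂ none = respond-slack inv slack v∈ m
    where
    slack : Slack Ps Ss Bs 0
    slack {S = S@(_ ∷ _)} P∈ S⊆P mS _ = ≰⇒> λ tight →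
      none (≤-trans (length-mono-≤ S⊆P) (length≤total P∈)) (lose P∈ (S , S⊆P , mS , refl , tight))
  ... | inj₁ (τ , tight , max) with find tight | sorted-insert τ [] (Invariant.sorted inv)
  ...   | Q , Q∈ , S , S⊆Q , mS , len , le | Cs , Ds , refl , τ≤Cs , Ds<τ , sorted′ =
    -- The place in the order was found for an empty block of type τ, which is now filled.
    convert Cs inv slack Q∈ S⊆Q mS len le τ≤Cs Ds<τ (sorted-replace Cs sorted′)
    where
    slack : Slack Ps Ss (Cs ++ Ds) (suc τ)
    slack {S = S@(_ ∷ _)} P∈ S⊆P mS τ< = ≰⇒> λ tight →
      max (s≤s⁻¹ τ<) (≤-trans (length-mono-≤ S⊆P) (length≤total P∈)) (lose P∈ (S , S⊆P , mS , refl , tight))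

-- From replies on lists to a strategy on subsets.

fromList : ∀ {n} → List (Fin n) → Subset n
fromList = foldr (λ x s → ⁅ x ⁆ ∪ s) Subset.⊥

∈-fromList⁺ : ∀ {n} {v : Fin n} {B} → v ∈ B → v Subset.∈ fromList B
∈-fromList⁺ {v = v} (here refl) = Subset.x∈p∪q⁺ (inj₁ (Subset.x∈⁅x⁆ v))
∈-fromList⁺         (there v∈B) = Subset.x∈p∪q⁺ (inj₂ (∈-fromList⁺ v∈B))

∈-fromList⁻ : ∀ {n} {v : Fin n} B → v Subset.∈ fromList B → v ∈ B
∈-fromList⁻ []      v∈ = contradiction v∈ Subset.∉⊥
∈-fromList⁻ (x ∷ B) v∈ = [ here ∘ Subset.x∈⁅y⁆⇒x≡y x , there ∘ ∈-fromList⁻ B ]′ (Subset.x∈p∪q⁻ ⁅ x ⁆ (fromList B) v∈)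

∈─⇒∉ : ∀ {n} {x : Fin n} (p q : Subset n) → x Subset.∈ p ─ q → ¬ (x Subset.∈ q)
∈─⇒∉ (inside  ∷ p) (inside ∷ q) () here
∈─⇒∉ (outside ∷ p) (inside ∷ q) () here
∈─⇒∉ (_       ∷ p) (inside  ∷ q) (there x∈) (there x∈q) = ∈─⇒∉ p q x∈ x∈q
∈─⇒∉ (_       ∷ p) (outside ∷ q) (there x∈) (there x∈q) = ∈─⇒∉ p q x∈ x∈q

module _ {n : ℕ} (G : Graph n) {K : Set} (class : Fin n → K)
         (class-independent : ∀ {u v} → class u ≡ class v → ¬ Graph._~_ G u v) where

  open Nat using (_+_)
  open Game class

  mark-≤ : ∀ V (f t : Fin n → ℕ) v → f v ∸ t v ≤ Game.Round.mk class (Subset._∈? V) v + (f v ∸ mark G V t v)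
  mark-≤ V f t v with v Subset.∈? V
  ... | yes _ = ≤-trans (n≤1+pred[n] (f v ∸ t v)) (≤-reflexive (cong suc (pred[m∸n]≡m∸[1+n] (f v) (t v))))
  ... | no  _ = ≤-refl

  -- Induction on a bound for the number of uncoloured vertices, as every reply colours one. Since
  -- allowances are truncated differences, their positivity says that Alice has not won.
  bobWins : ∀ b {f U t Ps Ss Bs} → ∣ U ∣ < b → Invariant (λ v → f v ∸ t v) Ps Ss Bs →
    (∀ {v} → v Subset.∈ U → Covered Ps Ss Bs v) → BobWins G f U t
  bobWins (suc b) {f} {U} {t} {Ps} {Ss} {Bs} U<b inv cover = play
    (λ {v} v∈U → ≰⇒> λ f≤t → contradiction (positive inv (cover v∈U)) (≤⇒≯ (≤-reflexive (m≤n⇒m∸n≡0 f≤t))))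
    move
    where
    move : ∀ V → Nonempty V → V Subset.⊆ U →
      ∃[ X ] X Subset.⊆ V × Independent G X × BobWins G f (U ─ X) (mark G V t)
    move V (v , v∈V) V⊆U with Response.respond class (Subset._∈? V) (mark-≤ V f t) inv (cover (V⊆U v∈V)) v∈V
    ... | Response.reply B coherent nonempty inv′ covers =
      X , Subset.p∩q⊆p V (fromList B) ,
      (λ u∈ w∈ → class-independent (coherent (X⊆B u∈) (X⊆B w∈))) ,
      bobWins b (<-≤-trans (Subset.p∩q≢∅⇒∣p─q∣<∣p∣ U X U∩X) (s≤s⁻¹ U<b)) inv′
        (λ {w} w∈ → covers (cover (Subset.p─q⊆p U X w∈))
          (λ (w∈V , w∈B) → ∈─⇒∉ U X w∈ (Subset.x∈p∩q⁺ (w∈V , ∈-fromList⁺ w∈B))))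
      where
      X : Subset n
      X = V ∩ fromList B
      X⊆B : ∀ {u} → u Subset.∈ X → u ∈ B
      X⊆B u∈ = ∈-fromList⁻ B (proj₂ (Subset.x∈p∩q⁻ V (fromList B) u∈))
      U∩X : Nonempty (U ∩ X)
      U∩X = let (x , x∈B , x∈V) = find nonempty in
            x , Subset.x∈p∩q⁺ (V⊆U x∈V , Subset.x∈p∩q⁺ (x∈V , ∈-fromList⁺ x∈B))

-- Decidability of the game and existence of the choice number.

module _ where
  open Nat using (_+_)

  sum-≤ : ∀ {A : Set} {h h′ : A → ℕ} xs → (∀ x → h′ x ≤ h x) → sum (map h′ xs) ≤ sum (map h xs)
  sum-≤ []       le = z≤n
  sum-≤ (x ∷ xs) le = +-mono-≤ (le x) (sum-≤ xs le)

  sum-< : ∀ {A : Set} {h h′ : A → ℕ} {x xs} → (∀ x → h′ x ≤ h x) → x ∈ xs → h′ x < h x →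
          sum (map h′ xs) < sum (map h xs)
  sum-< {xs = x ∷ xs} le (here refl) lt = +-mono-<-≤ lt (sum-≤ xs le)
  sum-< {xs = y ∷ xs} le (there x∈)  lt = +-mono-≤-< (le y) (sum-< le x∈ lt)

least : ∀ {P : Pred ℕ 0ℓ} → Decidable P → ∀ {d} → P d → ∃[ c ] P c × (∀ e → P e → c ≤ e)
least {P} P? {d} pd with search (suc d)
  where
  search : ∀ b → (∃[ c ] P c × (∀ e → P e → c ≤ e)) ⊎ (∀ {e} → e < b → ¬ P e)
  search zero = inj₂ λ ()
  search (suc b) with search b | P? b
  ... | inj₁ found | _      = inj₁ found
  ... | inj₂ none  | yes pb = inj₁ (b , pb , λ e pe → ≮⇒≥ λ e<b → none e<b pe)
  ... | inj₂ none  | no ¬pb = inj₂ λ {e} e<1+b pe →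
    [ (λ e<b → none e<b pe) , (λ { refl → ¬pb pe }) ]′ (m≤n⇒m<n∨m≡n (s≤s⁻¹ e<1+b))
... | inj₁ found = found
... | inj₂ none  = contradiction pd (none ≤-refl)

module _ {n : ℕ} (G : Graph n) where
  open Graph G

  independent? : Decidable (Independent G)
  independent? X = map′ (λ ind {u} {v} → ind u v) (λ ind u v → ind)
    (Fin.all? λ u → Fin.all? λ v → (u Subset.∈? X) →-dec (v Subset.∈? X) →-dec ¬? (u ~? v))

  allSubset? : ∀ {P : Pred (Subset n) 0ℓ} → Decidable P → Dec (∀ V → P V)
  allSubset? P? with Subset.anySubset? (¬? ∘ P?)
  ... | yes (V , ¬p) = no λ p → ¬p (p V)
  ... | no  none     = yes λ V → decidable-stable (P? V) λ ¬p → none (V , ¬p)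

  -- The measure for the search: Alice always marks some vertex with marks left, so it falls in
  -- every round.
  remaining : (f t : Fin n → ℕ) → ℕ
  remaining f t = sum (map (λ v → f v ∸ t v) (allFin n))

  mark-<  : ∀ {f t V v} → v Subset.∈ V → t v < f v → remaining f (mark G V t) < remaining f t
  mark-< {f} {t} {V} {v} v∈V t<f = sum-< le (∈-allFin v) lt
    where
    le : ∀ w → f w ∸ mark G V t w ≤ f w ∸ t w
    le w with w Subset.∈? V
    ... | yes _ = ∸-monoʳ-≤ (f w) (n≤1+n (t w))
    ... | no  _ = ≤-refl
    lt : f v ∸ mark G V t v < f v ∸ t v
    lt with v Subset.∈? V
    ... | yes _   = ∸-monoʳ-< ≤-refl t<f
    ... | no  v∉V = contradiction v∈V v∉V

  -- Exhaustive search of the game tree. Deciding choosability is what yields a least number of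
  -- colours constructively.
  bobWins? : ∀ b f U t → remaining f t < b → Dec (BobWins G f U t)
  bobWins? (suc b) f U t <b with Fin.all? (λ v → (v Subset.∈? U) →-dec (t v <? f v))
  ... | no ¬safe = no λ { (play safe _) → ¬safe (λ v → safe) }
  ... | yes safe = map′ (play λ {v} → safe v) (λ { (play _ move) → move }) (allSubset? move?)
    where
    move? : ∀ V → Dec (Nonempty V → V Subset.⊆ U →
      ∃[ X ] X Subset.⊆ V × Independent G X × BobWins G f (U ─ X) (mark G V t))
    move? V with Subset.nonempty? V | V Subset.⊆? U
    ... | no  empty     | _      = yes λ nonempty _ → contradiction nonempty empty
    ... | yes _         | no V⊈U = yes λ _ V⊆U → contradiction (λ {v} → V⊆U {v}) V⊈U
    ... | yes (v , v∈V) | yes V⊆U = map′ (λ r _ _ → r) (λ r → r (v , v∈V) V⊆U)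
      (Subset.anySubset? λ X → (X Subset.⊆? V) ×-dec independent? X ×-dec
        bobWins? b f (U ─ X) (mark G V t) (<-≤-trans (mark-< v∈V (safe v (V⊆U v∈V))) (s≤s⁻¹ <b)))

  onlineChoosable? : ∀ f → Dec (OnlineChoosable G f)
  onlineChoosable? f = bobWins? (suc (remaining f (λ _ → 0))) f Subset.⊤ (λ _ → 0) ≤-refl

-- The initial position on the complete multipartite graph.

module _ where
  open Nat using (_+_)

  sum-const : ∀ {A : Set} c (xs : List A) → sum (map (λ _ → c) xs) ≡ length xs * c
  sum-const c []       = refl
  sum-const c (x ∷ xs) = cong (c +_) (sum-const c xs)

  ∑-* : ∀ k s (a : ℕ → ℕ) → ∑ s (λ i → k * a i) ≡ k * ∑ s a
  ∑-* k zero    a = sym (*-zeroʳ k)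
  ∑-* k (suc s) a = trans (cong (_+ k * a s) (∑-* k s a)) (sym (*-distribˡ-+ k (∑ s a) (a s)))

  -- With k normal parts of equal size and no blocks, each level is k times a weight, and the
  -- invariant reduces to one inequality per set size.
  uniform-choosable : ∀ m k L → 2 ≤ m →
    (∀ s → s ≤ m → k * ∑ s (λ i → weight i m) ≤ s * L + discount s m) →
    OnlineChoosable (completeMultipartite m k) (λ _ → L)
  uniform-choosable m k L 2≤m bound = bobWins (completeMultipartite m k) (quotient {k} m) (λ eq ≢ → ≢ eq)
    (suc ∣ Subset.⊤ {k * m} ∣) ≤-refl
    record
      { large   = λ P∈ → ≤-trans 2≤m (≤-reflexive (sym (length-part P∈)))
      ; dense   = dense
      ; rankedS = tt
      ; rankedB = tt
      ; sorted  = []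
      ; classP  = homogeneous
      ; classS  = []
      ; classB  = []
      }
    (λ {v} _ → inj₁ (covered v))
    where
    part : Fin k → List (Fin (k * m))
    part i = map (combine i) (allFin m)
    Ps : List (List (Fin (k * m)))
    Ps = map part (allFin k)

    length-part′ : ∀ i → length (part i) ≡ m
    length-part′ i = trans (length-map (combine i) (allFin m)) (length-tabulate {n = m} (λ z → z))

    length-part : ∀ {P} → P ∈ Ps → length P ≡ m
    length-part P∈ with ∈-map⁻ part P∈
    ... | i , _ , refl = length-part′ i

    homogeneous : ∀ {P} → P ∈ Ps → Game.Homogeneous (quotient {k} m) P
    homogeneous P∈ u∈ v∈ with ∈-map⁻ part P∈
    ... | i , _ , refl with ∈-map⁻ (combine i) u∈ | ∈-map⁻ (combine i) v∈
    ...   | x , _ , refl | y , _ , refl =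
      trans (cong proj₁ (Fin.remQuot-combine i x)) (sym (cong proj₁ (Fin.remQuot-combine i y)))

    covered : ∀ v → Any (v ∈_) Ps
    covered v = lose (∈-map⁺ part (∈-allFin (quotient {k} m v)))
      (subst (_∈ part (quotient {k} m v)) (Fin.combine-remQuot {k} m v)
        (∈-map⁺ (combine (quotient {k} m v)) (∈-allFin (remainder {k} m v))))

    level-Ps : ∀ i → level i Ps ≡ k * weight i m
    level-Ps i = begin
      sum (map (weight i ∘ length) (map part (allFin k)))   ≡⟨ cong sum (map-∘ (allFin k)) ⟨
      sum (map (weight i ∘ length ∘ part) (allFin k))       ≡⟨ cong sum (map-cong (cong (weight i) ∘ length-part′) (allFin k)) ⟩
      sum (map (λ _ → weight i m) (allFin k))               ≡⟨ sum-const (weight i m) (allFin k) ⟩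
      length (allFin k) * weight i m                        ≡⟨ cong (_* weight i m) (length-tabulate {n = k} (λ z → z)) ⟩
      k * weight i m                                        ∎
      where open ≡-Reasoning

    total-Ps : ∀ i → total Ps [] [] i ≤ k * weight i m
    total-Ps zero    = ≤-reflexive (level-Ps 0)
    total-Ps (suc i) = ≤-reflexive (trans (+-identityʳ _) (level-Ps (suc i)))

    dense : ∀ {P S} → P ∈ Ps → S ⊆ P →
      demand Ps [] [] (length S) ≤ sum (map (λ _ → L) S) + discount (length S) (length P)
    dense {P} {S} P∈ S⊆P = begin
      demand Ps [] [] (length S)                           ≤⟨ ∑-mono (length S) total-Ps ⟩
      ∑ (length S) (λ i → k * weight i m)                  ≡⟨ ∑-* k (length S) (λ i → weight i m) ⟩
      k * ∑ (length S) (λ i → weight i m)                  ≤⟨ bound (length S) (≤-trans (length-mono-≤ S⊆P)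
                                                               (≤-reflexive (length-part P∈))) ⟩
      length S * L + discount (length S) m                 ≡⟨ cong₂ (λ y z → y + discount (length S) z)
                                                               (sum-const L S) (length-part P∈) ⟨
      sum (map (λ _ → L) S) + discount (length S) (length P) ∎
      where open ≤-Reasoning

  -- The closed form 2 G_s = s (2m + 1) + 2 - s² - 2m for s = `suc i`, free of subtraction. As s is
  -- at most m, the maximum with 1 never takes effect.
  ∑-weight : ∀ i {m} d → m ≡ suc (i + d) →
    2 * ∑ (suc i) (λ j → weight j m) + suc i * suc i + 2 * m ≡ suc i * (2 * m + 1) + 2
  ∑-weight zero    {m} d _    = eq m
    where
    eq : ∀ m → 3 + 2 * m ≡ 1 * (2 * m + 1) + 2
    eq = solve-∀
  ∑-weight (suc i) {m} d refl = begin
    2 * (∑ (suc i) (λ j → weight j m) + weight (suc i) m) + (2 + i) * (2 + i) + 2 * m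
      ≡⟨ cong (λ z → 2 * (∑ (suc i) (λ j → weight j m) + z) + (2 + i) * (2 + i) + 2 * m) last ⟩
    2 * (∑ (suc i) (λ j → weight j m) + suc d) + (2 + i) * (2 + i) + 2 * m
      ≡⟨ eq₁ (∑ (suc i) (λ j → weight j m)) i d ⟩
    2 * ∑ (suc i) (λ j → weight j m) + suc i * suc i + 2 * m + (2 * m + 1)
      ≡⟨ cong (_+ (2 * m + 1)) (∑-weight i {m} (suc d) (cong suc (sym (+-suc i d)))) ⟩
    suc i * (2 * m + 1) + 2 + (2 * m + 1)
      ≡⟨ eq₂ i (2 * m + 1) ⟩
    (2 + i) * (2 * m + 1) + 2  ∎
    where
    open ≡-Reasoning
    last : weight (suc i) (suc (suc (i + d))) ≡ suc d
    last = trans (cong (_⊔ 1) (trans (cong (_∸ suc i) (sym (+-suc (suc i) d))) (m+n∸m≡n (suc i) (suc d))))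
                 (cong suc (⊔-identityʳ d))
    eq₁ : ∀ x i d → 2 * (x + suc d) + (2 + i) * (2 + i) + 2 * suc (suc (i + d)) ≡
                    2 * x + suc i * suc i + 2 * suc (suc (i + d)) + (2 * suc (suc (i + d)) + 1)
    eq₁ = solve-∀
    eq₂ : ∀ i y → suc i * y + 2 + y ≡ (2 + i) * y + 2
    eq₂ = solve-∀

  -- AM-GM without roots: the two sides differ by the square of the distance between `x` and `y`.
  4xy≤[x+y]² : ∀ x y → 4 * (x * y) ≤ (x + y) * (x + y)
  4xy≤[x+y]² x y with ≤-total x y
  ... | inj₁ x≤y rewrite sym (m+[n∸m]≡n x≤y) = ≤-trans (m≤m+n _ ((y ∸ x) * (y ∸ x))) (≤-reflexive (eq x (y ∸ x)))
    where
    eq : ∀ x d → 4 * (x * (x + d)) + d * d ≡ (x + (x + d)) * (x + (x + d))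
    eq = solve-∀
  ... | inj₂ y≤x rewrite sym (m+[n∸m]≡n y≤x) = ≤-trans (m≤m+n _ ((x ∸ y) * (x ∸ y))) (≤-reflexive (eq y (x ∸ y)))
    where
    eq : ∀ y d → 4 * ((y + d) * y) + d * d ≡ ((y + d) + y) * ((y + d) + y)
    eq = solve-∀

-- The number of colours and its upper bound.

module Quota (n k : ℕ) .{{_ : NonZero k}} where
  open Nat using (_+_; _/_; _%_)

  m : ℕ
  m = 3 + n

  G : ℕ → ℕ
  G s = ∑ s (λ i → weight i m)

  quota : ℕ → ℕ
  quota i = k * G (suc i) / suc i

  -- Only the sizes from 1 to m - 1 compete; the whole part is treated by `whole-bound`.
  chosen : ∃[ i ] i < 2 + n × (∀ {j} → j < 2 + n → quota j ≤ quota i)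
  chosen with argmax quota (upTo (2 + n))
  ... | inj₂ (i , i∈ , max) = i , ∈-upTo⁻ i∈ , λ j< → max (∈-upTo⁺ j<)

  i₀ L : ℕ
  i₀ = proj₁ chosen
  L = quota i₀

  -- The remainder of the division is at most `j`, the discount of a proper subset with `suc j`
  -- vertices.
  quota-bound : ∀ {j} → j < 2 + n → k * G (suc j) ≤ suc j * L + j
  quota-bound {j} j< = begin
    k * G (suc j)                                        ≡⟨ m≡m%n+[m/n]*n (k * G (suc j)) (suc j) ⟩
    k * G (suc j) % suc j + quota j * suc j              ≤⟨ +-mono-≤ (s≤s⁻¹ (m%n<n (k * G (suc j)) (suc j)))
                                                              (*-monoˡ-≤ (suc j) (proj₂ (proj₂ chosen) j<)) ⟩
    j + L * suc j                                        ≡⟨ eq j L ⟩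
    suc j * L + j                                        ∎
    where
    open ≤-Reasoning
    eq : ∀ j L → j + L * suc j ≡ suc j * L + j
    eq = solve-∀

  -- Twice the bound for m - 1 vertices reads k m (m - 1) ≤ 2 (m - 1) L + 2 (m - 2); by
  -- integrality k m ≤ 2 L + 1, which yields the bound for the whole part.
  km≤2L+1 : k * m ≤ 2 * L + 1
  km≤2L+1 = s≤s⁻¹ (*-cancelˡ-< (2 + n) _ _ (begin-strict
    (2 + n) * (k * m)                         ≡⟨ trans (eq₁ n k) (cong (k *_) closed) ⟩
    k * (2 * G (2 + n))                       ≡⟨ eq₂ k (G (2 + n)) ⟩
    2 * (k * G (2 + n))                       ≤⟨ *-monoʳ-≤ 2 (quota-bound ≤-refl) ⟩
    2 * ((2 + n) * L + suc n)                 <⟨ ≤-reflexive (eq₃ n L) ⟩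
    (2 + n) * (2 * L + 1) + n + 1             ≤⟨ ≤-trans (m≤m+n _ 1) (≤-reflexive (eq₄ n L)) ⟩
    (2 + n) * suc (2 * L + 1)                 ∎))
    where
    open ≤-Reasoning
    eq₁ : ∀ n k → (2 + n) * (k * (3 + n)) ≡ k * ((2 + n) * (3 + n))
    eq₁ = solve-∀
    eq₂ : ∀ k x → k * (2 * x) ≡ 2 * (k * x)
    eq₂ = solve-∀
    eq₃ : ∀ n L → suc (2 * ((2 + n) * L + suc n)) ≡ (2 + n) * (2 * L + 1) + n + 1
    eq₃ = solve-∀
    eq₄ : ∀ n L → (2 + n) * (2 * L + 1) + n + 1 + 1 ≡ (2 + n) * suc (2 * L + 1)
    eq₄ = solve-∀
    eq₅ : ∀ n → (2 + n) * (2 * (3 + n) + 1) + 2 ≡ (2 + n) * (3 + n) + (2 + n) * (2 + n) + 2 * (3 + n)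
    eq₅ = solve-∀
    closed : (2 + n) * m ≡ 2 * G (2 + n)
    closed = sym (+-cancelʳ-≡ ((2 + n) * (2 + n)) _ _ (+-cancelʳ-≡ (2 * m) _ _
      (trans (∑-weight (suc n) {m} 1 (cong (2 +_) (+-comm 1 n))) (eq₅ n))))

  -- Combines 2 G_m = m² - (m - 2) with k m ≤ 2 L + 1. Here `suc n` is m - 2, the discount of the
  -- whole part, and k ≥ 1 allows it to be multiplied by k.
  whole-bound : k * G m ≤ m * L + suc n
  whole-bound = *-cancelˡ-≤ 2 (+-cancelʳ-≤ (suc n) _ _ (begin
    2 * (k * G m) + suc n                   ≤⟨ +-monoʳ-≤ (2 * (k * G m)) (m≤n*m (suc n) k) ⟩
    2 * (k * G m) + k * suc n               ≡⟨ eq₁ n k (G m) ⟩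
    k * (2 * G m + suc n)                   ≡⟨ cong (k *_) closed ⟩
    k * (m * m)                             ≡⟨ eq₂ k m ⟩
    m * (k * m)                             ≤⟨ *-monoʳ-≤ m km≤2L+1 ⟩
    m * (2 * L + 1)                         ≤⟨ m≤m+n _ (2 * n) ⟩
    m * (2 * L + 1) + 2 * n                 ≡⟨ eq₃ n L ⟩
    2 * (m * L + suc n) + suc n             ∎))
    where
    open ≤-Reasoning
    eq₁ : ∀ n k x → 2 * (k * x) + k * suc n ≡ k * (2 * x + suc n)
    eq₁ = solve-∀
    eq₂ : ∀ k m → k * (m * m) ≡ m * (k * m)
    eq₂ = solve-∀
    eq₃ : ∀ n L → (3 + n) * (2 * L + 1) + 2 * n ≡ 2 * ((3 + n) * L + suc n) + suc n
    eq₃ = solve-∀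
    eq₄ : ∀ n → (3 + n) * (2 * (3 + n) + 1) + 2 + suc n ≡ (3 + n) * (3 + n) + (3 + n) * (3 + n) + 2 * (3 + n)
    eq₄ = solve-∀
    eq₅ : ∀ w x y z → w + x + y + z ≡ w + z + x + y
    eq₅ = solve-∀
    closed : 2 * G m + suc n ≡ m * m
    closed = +-cancelʳ-≡ (m * m) _ _ (+-cancelʳ-≡ (2 * m) _ _
      (trans (sym (eq₅ (2 * G m) (m * m) (2 * m) (suc n)))
        (trans (cong (_+ suc n) (∑-weight (2 + n) {m} 0 (cong (3 +_) (sym (+-identityʳ n))))) (eq₄ n))))

  bound : ∀ s → s ≤ m → k * G s ≤ s * L + discount s m
  bound zero    _         = ≤-reflexive (*-zeroʳ k)
  bound (suc j) (s≤s j≤) with m≤n⇒m<n∨m≡n j≤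
  ... | inj₁ j<   = subst (λ z → k * G (suc j) ≤ suc j * L + pred z) (sym (m≤n⇒m⊓n≡m j<)) (quota-bound j<)
  ... | inj₂ refl = subst (λ z → k * G m ≤ m * L + pred z) (sym (m≥n⇒m⊓n≡n (n≤1+n (2 + n)))) whole-bound

  choosable : OnlineChoosable (completeMultipartite m k) (λ _ → L)
  choosable = uniform-choosable m k L (s≤s (s≤s z≤n)) bound

  -- D is twice the distance from L to (m + 1/2) k, and the second claim is D ≥ 2 k √(2m - 2)
  -- squared. For the size s that attains the maximum, s D ≥ k (s² + 2m - 2), and AM-GM bounds the
  -- square of the right side.
  gap : ∃[ D ] 2 * L + D ≡ (2 * m + 1) * k × 4 * (k * k * (2 * (2 + n))) ≤ D * D
  gap = D , m+[n∸m]≡n 2L≤ , *-cancelˡ-≤ (s * s) (begin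
    s * s * (4 * (k * k * N))               ≡⟨ eq₁ s k N ⟩
    k * k * (4 * (s * s * N))               ≤⟨ *-monoʳ-≤ (k * k) (4xy≤[x+y]² (s * s) N) ⟩
    k * k * ((s * s + N) * (s * s + N))     ≡⟨ eq₂ k (s * s + N) ⟩
    k * (s * s + N) * (k * (s * s + N))     ≤⟨ *-mono-≤ below below ⟩
    s * D * (s * D)                         ≡⟨ eq₃ s D ⟩
    s * s * (D * D)                         ∎)
    where
    open ≤-Reasoning
    s N D : ℕ
    s = suc i₀
    N = 2 * (2 + n)
    D = (2 * m + 1) * k ∸ 2 * L
    closed : 2 * G s + (s * s + N) ≡ s * (2 * m + 1)
    closed = +-cancelʳ-≡ 2 _ _ (trans (eq₄ (2 * G s) (s * s) n)
      (∑-weight i₀ {m} (2 + n ∸ i₀) (cong suc (sym (m+[n∸m]≡n (<⇒≤ (proj₁ (proj₂ chosen))))))))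
      where
      eq₄ : ∀ x y n → x + (y + 2 * (2 + n)) + 2 ≡ x + y + 2 * (3 + n)
      eq₄ = solve-∀
    budget : s * (2 * L) + k * (s * s + N) ≤ s * ((2 * m + 1) * k)
    budget = begin
      s * (2 * L) + k * (s * s + N)             ≡⟨ cong (_+ k * (s * s + N)) (eq₅ s L) ⟩
      2 * (L * s) + k * (s * s + N)             ≤⟨ +-monoˡ-≤ _ (*-monoʳ-≤ 2 (m/n*n≤m (k * G s) s)) ⟩
      2 * (k * G s) + k * (s * s + N)           ≡⟨ eq₆ k (G s) (s * s + N) ⟩
      k * (2 * G s + (s * s + N))               ≡⟨ cong (k *_) closed ⟩
      k * (s * (2 * m + 1))                     ≡⟨ eq₇ k s (2 * m + 1) ⟩
      s * ((2 * m + 1) * k)                     ∎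
      where
      eq₅ : ∀ s L → s * (2 * L) ≡ 2 * (L * s)
      eq₅ = solve-∀
      eq₆ : ∀ k x y → 2 * (k * x) + k * y ≡ k * (2 * x + y)
      eq₆ = solve-∀
      eq₇ : ∀ k s y → k * (s * y) ≡ s * (y * k)
      eq₇ = solve-∀
    2L≤ : 2 * L ≤ (2 * m + 1) * k
    2L≤ = *-cancelˡ-≤ s (≤-trans (m≤m+n _ _) budget)
    below : k * (s * s + N) ≤ s * D
    below = +-cancelˡ-≤ (s * (2 * L)) _ _ (begin
      s * (2 * L) + k * (s * s + N)             ≤⟨ budget ⟩
      s * ((2 * m + 1) * k)                     ≡⟨ cong (s *_) (m+[n∸m]≡n 2L≤) ⟨
      s * (2 * L + D)                           ≡⟨ *-distribˡ-+ s (2 * L) D ⟩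
      s * (2 * L) + s * D                       ∎)
    eq₁ : ∀ s k N → s * s * (4 * (k * k * N)) ≡ k * k * (4 * (s * s * N))
    eq₁ = solve-∀
    eq₂ : ∀ k y → k * k * (y * y) ≡ k * y * (k * y)
    eq₂ = solve-∀
    eq₃ : ∀ s D → s * D * (s * D) ≡ s * s * (D * D)
    eq₃ = solve-∀

-- Passage from natural numbers to rationals.

ι : ℕ → ℚ
ι n = ℤ.+ n ℚ./ 1

toℚᵘ-ι : ∀ n → ℚ.toℚᵘ (ι n) ℚᵘ.≃ ℚᵘ.mkℚᵘ (ℤ.+ n) 0
toℚᵘ-ι n = ℚ.toℚᵘ-fromℚᵘ (ℚᵘ.mkℚᵘ (ℤ.+ n) 0)

module _ where
  open Nat using (_+_)

  ι-+ : ∀ a b → ι (a + b) ≡ ι a ℚ.+ ι b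
  ι-+ a b = ℚ.toℚᵘ-injective (begin
    ℚ.toℚᵘ (ι (a + b))                                     ≈⟨ toℚᵘ-ι (a + b) ⟩
    ℚᵘ.mkℚᵘ (ℤ.+ (a + b)) 0                                ≈⟨ ℚᵘ.*≡* (cong (ℤ._* ℤ.+ 1) (cong₂ ℤ._+_ (sym (ℤ.*-identityʳ (ℤ.+ a))) (sym (ℤ.*-identityʳ (ℤ.+ b))))) ⟩
    ℚᵘ.mkℚᵘ (ℤ.+ a) 0 ℚᵘ.+ ℚᵘ.mkℚᵘ (ℤ.+ b) 0               ≈⟨ ℚᵘ.+-cong (toℚᵘ-ι a) (toℚᵘ-ι b) ⟨
    ℚ.toℚᵘ (ι a) ℚᵘ.+ ℚ.toℚᵘ (ι b)                         ≈⟨ ℚ.toℚᵘ-homo-+ (ι a) (ι b) ⟨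
    ℚ.toℚᵘ (ι a ℚ.+ ι b)                                   ∎)
    where open ℚᵘ.≃-Reasoning

  ι-* : ∀ a b → ι (a * b) ≡ ι a ℚ.* ι b
  ι-* a b = ℚ.toℚᵘ-injective (begin
    ℚ.toℚᵘ (ι (a * b))                                     ≈⟨ toℚᵘ-ι (a * b) ⟩
    ℚᵘ.mkℚᵘ (ℤ.+ (a * b)) 0                                ≈⟨ ℚᵘ.*≡* (cong (ℤ._* ℤ.+ 1) (ℤ.pos-* a b)) ⟩
    ℚᵘ.mkℚᵘ (ℤ.+ a) 0 ℚᵘ.* ℚᵘ.mkℚᵘ (ℤ.+ b) 0               ≈⟨ ℚᵘ.*-cong (toℚᵘ-ι a) (toℚᵘ-ι b) ⟨
    ℚ.toℚᵘ (ι a) ℚᵘ.* ℚ.toℚᵘ (ι b)                         ≈⟨ ℚ.toℚᵘ-homo-* (ι a) (ι b) ⟨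
    ℚ.toℚᵘ (ι a ℚ.* ι b)                                   ∎)
    where open ℚᵘ.≃-Reasoning

  ι-nonneg : ∀ n → ℚ.0ℚ ℚ.≤ ι n
  ι-nonneg n = ℚ.nonNegative⁻¹ (ι n) {{ℚ.normalize-nonNeg n 1}}

  ι-mono : ∀ {a b} → a ≤ b → ι a ℚ.≤ ι b
  ι-mono {a} {b} a≤b = subst₂ ℚ._≤_ (ℚ.+-identityʳ (ι a))
    (trans (sym (ι-+ a (b ∸ a))) (cong ι (m+[n∸m]≡n a≤b))) (ℚ.+-monoʳ-≤ (ι a) (ι-nonneg (b ∸ a)))

  -- Doubling is written as addition, the form in which `below-bound` takes it.
  gap-ι : ∀ m k L D → 2 * L + D ≡ (2 * m + 1) * k → ι L ℚ.+ ι L ℚ.+ ι D ≡ (ι m ℚ.+ ι m ℚ.+ ℚ.1ℚ) ℚ.* ι k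
  gap-ι m k L D eq = begin
    ι L ℚ.+ ι L ℚ.+ ι D                   ≡⟨ cong (ℚ._+ ι D) (ι-+ L L) ⟨
    ι (L + L) ℚ.+ ι D                     ≡⟨ ι-+ (L + L) D ⟨
    ι (L + L + D)                         ≡⟨ cong ι (trans (double L D) (trans eq (double′ m k))) ⟩
    ι ((m + m + 1) * k)                   ≡⟨ ι-* (m + m + 1) k ⟩
    ι (m + m + 1) ℚ.* ι k                 ≡⟨ cong (ℚ._* ι k) (trans (ι-+ (m + m) 1) (cong (ℚ._+ ℚ.1ℚ) (ι-+ m m))) ⟩
    (ι m ℚ.+ ι m ℚ.+ ℚ.1ℚ) ℚ.* ι k        ∎
    where
    open ≡-Reasoning
    double : ∀ L D → L + L + D ≡ 2 * L + D
    double = solve-∀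
    double′ : ∀ m k → (2 * m + 1) * k ≡ (m + m + 1) * k
    double′ = solve-∀

  square-gap-ι : ∀ n k D → 4 * (k * k * (2 * (2 + n))) ≤ D * D →
    (ι k ℚ.+ ι k) ℚ.* (ι k ℚ.+ ι k) ℚ.* ι (2 * (3 + n) ∸ 2) ℚ.≤ ι D ℚ.* ι D
  square-gap-ι n k D le = subst₂ ℚ._≤_
    (trans (ι-* ((k + k) * (k + k)) (2 * (3 + n) ∸ 2))
      (cong (ℚ._* ι (2 * (3 + n) ∸ 2)) (trans (ι-* (k + k) (k + k)) (cong (λ z → z ℚ.* z) (ι-+ k k)))))
    (ι-* D D)
    (ι-mono (≤-trans (≤-reflexive (trans (cong ((k + k) * (k + k) *_) 2m-2) (regroup k n))) le))
    where
    2m-2 : 2 * (3 + n) ∸ 2 ≡ 2 * (2 + n)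
    2m-2 = cong (_∸ 2) (twice n)
      where
      twice : ∀ n → 2 * (3 + n) ≡ 2 + 2 * (2 + n)
      twice = solve-∀
    regroup : ∀ k n → (k + k) * (k + k) * (2 * (2 + n)) ≡ 4 * (k * k * (2 * (2 + n)))
    regroup = solve-∀

0<* : ∀ {p q} → ℚ.0ℚ ℚ.< p → ℚ.0ℚ ℚ.< q → ℚ.0ℚ ℚ.< p ℚ.* q
0<* {p} {q} 0<p 0<q = ℚ.positive⁻¹ (p ℚ.* q) {{ℚ.pos*pos⇒pos p {{ℚ.positive 0<p}} q {{ℚ.positive 0<q}}}}

square-< : ∀ {p q} → ℚ.0ℚ ℚ.≤ p → p ℚ.< q → p ℚ.* p ℚ.< q ℚ.* q
square-< {p} {q} 0≤p p<q = ℚ.≤-<-trans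
  (ℚ.*-monoˡ-≤-nonNeg p {{ℚ.nonNegative 0≤p}} (ℚ.<⇒≤ p<q))
  (ℚ.*-monoˡ-<-pos q {{ℚ.positive (ℚ.≤-<-trans 0≤p p<q)}} p<q)

-- Membership of q in the lower cut of (μ + ½ - √N) κ, where κ i = 1; scaled by κ + κ, the
-- point y at which the cut of √N is queried exceeds d.
below-bound : ∀ κ i μ q l d N → ℚ.0ℚ ℚ.< κ → κ ℚ.* i ≡ ℚ.1ℚ → q ℚ.< l → ℚ.0ℚ ℚ.≤ d →
  l ℚ.+ l ℚ.+ d ≡ (μ ℚ.+ μ ℚ.+ ℚ.1ℚ) ℚ.* κ →
  (κ ℚ.+ κ) ℚ.* (κ ℚ.+ κ) ℚ.* N ℚ.≤ d ℚ.* d →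
  let y = ℚ.- (q ℚ.* i ℚ.- (μ ℚ.+ ℚ.½)) in ℚ.0ℚ ℚ.< y × N ℚ.< y ℚ.* y
below-bound κ i μ q l d N 0<κ κi≡1 q<l 0≤d sum≡ sq≤ =
  ℚ.*-cancelˡ-<-nonNeg κ₂ {{ℚ.nonNegative (ℚ.<⇒≤ 0<κ₂)}}
    (subst (ℚ._< κ₂ ℚ.* y) (sym (ℚ.*-zeroʳ κ₂)) (ℚ.≤-<-trans 0≤d d<)) ,
  ℚ.*-cancelˡ-<-nonNeg (κ₂ ℚ.* κ₂) {{ℚ.nonNegative (ℚ.<⇒≤ (0<* 0<κ₂ 0<κ₂))}}
    (ℚ.≤-<-trans sq≤ (subst (d ℚ.* d ℚ.<_) (sq κ₂ y) (square-< 0≤d d<)))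
  where
  open +-*-Solver
  κ₂ y : ℚ
  κ₂ = κ ℚ.+ κ
  y = ℚ.- (q ℚ.* i ℚ.- (μ ℚ.+ ℚ.½))
  0<κ₂ : ℚ.0ℚ ℚ.< κ₂
  0<κ₂ = ℚ.+-mono-< 0<κ 0<κ
  sq : ∀ x y → x ℚ.* y ℚ.* (x ℚ.* y) ≡ x ℚ.* x ℚ.* (y ℚ.* y)
  sq = solve 2 (λ x y → x :* y :* (x :* y) := x :* x :* (y :* y)) refl
  scaled : ∀ κ i μ q h → (κ ℚ.+ κ) ℚ.* (ℚ.- (q ℚ.* i ℚ.- (μ ℚ.+ h))) ≡
    (μ ℚ.+ μ ℚ.+ (h ℚ.+ h)) ℚ.* κ ℚ.- (q ℚ.+ q) ℚ.* (κ ℚ.* i)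
  scaled = solve 5 (λ κ i μ q h → (κ :+ κ) :* (:- (q :* i :- (μ :+ h))) :=
    (μ :+ μ :+ (h :+ h)) :* κ :- (q :+ q) :* (κ :* i)) refl
  κ₂y : κ₂ ℚ.* y ≡ (l ℚ.+ l ℚ.+ d) ℚ.- (q ℚ.+ q)
  κ₂y = trans (scaled κ i μ q ℚ.½) (cong₂ ℚ._-_ (sym sum≡)
    (trans (cong ((q ℚ.+ q) ℚ.*_) κi≡1) (ℚ.*-identityʳ (q ℚ.+ q))))
  d< : d ℚ.< κ₂ ℚ.* y
  d< = subst₂ ℚ._<_ (solve 2 (λ q d → (q :+ q :+ d) :- (q :+ q) := d) refl q d) (sym κ₂y)
    (ℚ.+-monoˡ-< (ℚ.- (q ℚ.+ q)) (ℚ.+-monoˡ-< d (ℚ.+-mono-< q<l q<l)))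

-- The bound for the on-line choice number.

open import Data.Integer using (+_)
open import Data.Rational using (_/_; _+_; ½)

corollary11 : ∀ (m k : ℕ) .{{_ : NonZero k}} → 3 ≤ m →
    ∃[ χₚ ] IsOnlineChoiceNumber (completeMultipartite m k) χₚ ×
    fromℚ (+ χₚ / 1) ≤ᵣ (+ m / 1 + ½ -ᵣ √ (2 * m ∸ 2)) *ᵣ k
corollary11 m@(suc (suc (suc n))) k (s≤s (s≤s (s≤s z≤n))) =
  let (χ , χ-choosable , χ-least) = least (λ d → onlineChoosable? (completeMultipartite m k) (λ _ → d)) (Quota.choosable n k)
      (D , 2L+D , gap≤) = Quota.gap n k
      L = Quota.L n k
  in χ , (χ-choosable , χ-least) , λ q q<χ →
    below-bound (ι k) (ℚ.1/_ (ι k) {{ℚ.pos⇒nonZero (ι k) {{ℚ.normalize-pos k 1}}}}) (ι m) q (ι L) (ι D) (ι (2 * m ∸ 2))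
      (ℚ.positive⁻¹ (ι k) {{ℚ.normalize-pos k 1}})
      (ℚ.*-inverseʳ (ι k) {{ℚ.pos⇒nonZero (ι k) {{ℚ.normalize-pos k 1}}}})
      -- By minimality the choice number is at most L, so `q` lies below L.
      (ℚ.<-≤-trans q<χ (ι-mono (χ-least L (Quota.choosable n k))))
      (ι-nonneg D)
      (gap-ι m k L D 2L+D)
      (square-gap-ι n k D gap≤)
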